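{- Let $k,d$ be positive integers and let $\lambda=(\lambda_1,\ldots,\lambda_\ell)$ and $\mu=(\mu_1,\ldots,\mu_\iota)$ be $k$-bounded partitions of $d$. Then the $k$-Kostka number $K^{(k)}_{\lambda,\mu}$ is nonzero if and only if $\mu\trianglelefteq\lambda$.
   Context: Partitions are Young diagrams in French notation (row $i$ counted bottom to top). A partition is $k$-bounded if its largest part is at most $k$. Hook length of a cell: number of cells directly to its right in its row or directly above it in its column, counting the cell once; a $(k+1)$-core is a partition with no cell of hook length $k+1$. The $(k+1)$-residue of cell $(i,j)$ is $j-i\bmod(k+1)$. $\mathfrak{c}(\lambda)$ denotes the unique $(k+1)$-core $\gamma$ such that, for every $i$, row $i$ of $\gamma$ has exactly $\lambda_i$ cells of hook length at most $k$ (Lapointe–Morse bijection between $k$-bounded partitions and $(k+1)$-cores). For a composition $\alpha$ of $d$, a semistandard $k$-tableau of shape $\mathfrak{c}(\lambda)$ and $k$-weight $\alpha$ is a semistandard Young tableau of shape $\mathfrak{c}(\lambda)$ (rows weakly increasing left to right, columns strictly increasing bottom to top) such that, for each $i$, the cells filled with $i$ have exactly $\alpha_i$ distinct $(k+1)$-residues. $K^{(k)}_{\lambda,\alpha}$ is the number of such tableaux. Dominance order: $\mu\trianglelefteq\lambda$ iff $\mu_1+\cdots+\mu_i\le\lambda_1+\cdots+\lambda_i$ for all $i$. -}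

module Defs where

open import Data.Nat using (ℕ; zero; suc; _+_; _*_; _∸_; _≤_; _<_; _≤?_; _<?_; _≤ᵇ_; _<ᵇ_; _≡ᵇ_)
open import Data.Nat.DivMod using (_%_)
open import Data.Bool using (Bool; true; false; _∧_; T?)
open import Data.Product using (_×_; _,_)
open import Data.List using (List; []; _∷_; [_]; length; take; drop; filter; map; concatMap; applyUpTo; upTo)
open import Data.Nat.ListAction using (sum)
open import Data.Bool.ListAction using (all; any)
open import Data.List.Relation.Unary.All using (All)
open import Data.List.Relation.Unary.Linked using (Linked)
open import Relation.Binary.PropositionalEquality using (_≡_; _≢_)
open import Data.Nat using (_≥_)

-- Partitions, as lists of parts λ₁ ≥ λ₂ ≥ … > 0.
-- Rows are indexed from 0 (row 0 = bottom row, French notation),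
-- columns from 0 (column 0 = leftmost).

at : List ℕ → ℕ → ℕ
at []       _       = 0
at (x ∷ xs) zero    = x
at (x ∷ xs) (suc i) = at xs i

IsPartition : List ℕ → Set
IsPartition p = Linked _≥_ p × All (0 <_) p

Bounded : ℕ → List ℕ → Set
Bounded k p = All (_≤ k) p

_⊴_ : List ℕ → List ℕ → Set
mu ⊴ lam = ∀ i → sum (take i mu) ≤ sum (take i lam)

leg : List ℕ → ℕ → ℕ → ℕ
leg γ i j = length (filter (j <?_) (drop (suc i) γ))

hook : List ℕ → ℕ → ℕ → ℕ
hook γ i j = (at γ i ∸ suc j) + leg γ i j + 1

IsCore : ℕ → List ℕ → Set
IsCore k γ = ∀ i j → j < at γ i → hook γ i j ≢ suc k

smallHooks : ℕ → List ℕ → ℕ → ℕ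
smallHooks k γ i = length (filter (λ j → hook γ i j ≤? k) (upTo (at γ i)))

-- γ = 𝔠(λ): γ is a (k+1)-core and, for every i, row i of γ has exactly
-- λᵢ cells of hook length ≤ k  (the Lapointe–Morse bijection).
IsCoreOf : ℕ → List ℕ → List ℕ → Set
IsCoreOf k lam γ = IsPartition γ × IsCore k γ × (∀ i → smallHooks k γ i ≡ at lam i)

-- a filling: list of rows (bottom to top), each a list of entries
Filling : Set
Filling = List (List ℕ)

rowOf : Filling → ℕ → List ℕ
rowOf []       _       = []
rowOf (r ∷ rs) zero    = r
rowOf (r ∷ rs) (suc i) = rowOf rs i

entry : Filling → ℕ → ℕ → ℕ
entry t i j = at (rowOf t i) j

words : ℕ → ℕ → List (List ℕ)
words zero    n = [ [] ]
words (suc m) n = concatMap (λ a → map (a ∷_) (words m n)) (applyUpTo suc n)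

fillings : List ℕ → ℕ → List Filling
fillings []      n = [ [] ]
fillings (r ∷ γ) n = concatMap (λ w → map (w ∷_) (fillings γ n)) (words r n)

rowWeak : List ℕ → Bool
rowWeak []           = true
rowWeak (x ∷ [])     = true
rowWeak (x ∷ y ∷ xs) = (x ≤ᵇ y) ∧ rowWeak (y ∷ xs)

colStrict : Filling → Bool
colStrict t = all (λ i → all (λ j → entry t i j <ᵇ entry t (suc i) j)
                              (upTo (length (rowOf t (suc i)))))
                  (upTo (length t))

cells : Filling → List (ℕ × ℕ)
cells t = concatMap (λ i → map (i ,_) (upTo (length (rowOf t i)))) (upTo (length t))

-- (k+1)-residue of cell (i , j): j - i mod (k+1)  (computed as j + k·i)
residue : ℕ → ℕ → ℕ → ℕ
residue k i j = (j + k * i) % suc k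

resCount : ℕ → Filling → ℕ → ℕ
resCount k t a =
  length (filter (λ r → T? (any (λ c → ((entry t (Data.Product.proj₁ c) (Data.Product.proj₂ c)) ≡ᵇ a)
                                     ∧ (residue k (Data.Product.proj₁ c) (Data.Product.proj₂ c) ≡ᵇ r))
                                (cells t)))
                 (upTo (suc k)))

kWeightOK : ℕ → List ℕ → Filling → Bool
kWeightOK k α t = all (λ a → resCount k t (suc a) ≡ᵇ at α a) (upTo (length α))

isKTableau : ℕ → List ℕ → Filling → Bool
isKTableau k α t = all rowWeak t ∧ colStrict t ∧ kWeightOK k α t

kKostka : ℕ → List ℕ → List ℕ → ℕ
kKostka k γ α = length (filter (λ t → T? (isKTableau k α t)) (fillings γ (length α)))

{-# OPTIONS --safe #-}
module Submission where

-- For γ = 𝔠(λ) put up(i) = i + (k + 1 − λᵢ).  Then γᵢ = λᵢ + γ_{up(i)}; in terms of the beads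
-- bᵢ = γᵢ − i this says b_{up(i)} = bᵢ − (k + 1), so that the beads are closed under
-- subtracting k + 1.
--
-- Necessity: in every semistandard filling of 𝔠(λ) the numbers of residues of the letters add up
-- to at least |λ|.  To see this, peel off the largest letter.  If r but not r + 1 is one of its
-- residues, then its cells of residue r are removable corners, and removing all removable corners
-- of residue r leaves a core for which |λ| drops by at most one.  If there is no such r, the letter
-- has all k + 1 residues, and replacing γ by (γ₂, γ₃, …) removes the letter and at most k from |λ|.
-- Applied to the rows > i, which only contain letters > i, this bounds the tails of λ by those of μ.
--
-- Sufficiency: let r be the last part of μ and p the last row with λₚ ≥ r, and let ν be λ with the
-- parts λₚ, λₚ₊₁ replaced by λₚ + λₚ₊₁ − r.  Then μ without r is dominated by ν, and 𝔠(λ)/𝔠(ν) is a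
-- horizontal strip with at most r residues, which is filled with the largest letter.  By the lower
-- bound the inequalities between numbers of residues and parts of μ are all equalities.

open import Defs
open import Data.Bool using (Bool; T; T?; _∧_)
open import Data.Bool.ListAction using (all; any)
open import Data.Bool.Properties using (T-∧)
open import Data.Nat
open import Data.Nat.DivMod using (_%_; m%n<n; m%n%n≡m%n; m<n⇒m%n≡m; [m+kn]%n≡m%n; %-distribˡ-+)
open import Data.Nat.ListAction using (sum)
open import Data.Nat.Properties
open import Data.Nat.Tactic.RingSolver using (solve)
open import Data.Empty using (⊥; ⊥-elim)
open import Data.List using (List; []; _∷_; _++_; applyUpTo; concatMap; drop; filter; length; map; take; upTo)
open import Data.List.Membership.DecPropositional _≟_ using (_∈?_)
open import Data.List.Membership.Propositional using (_∈_; _∉_; find; lose)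
open import Data.List.Membership.Propositional.Properties
  using (∈-++⁺ʳ; ∈-applyUpTo⁺; ∈-applyUpTo⁻; ∈-concatMap⁺; ∈-concatMap⁻; ∈-filter⁺; ∈-filter⁻;
         ∈-length; ∈-map⁺; ∈-map⁻; ∈-upTo⁺; ∈-upTo⁻)
open import Data.List.Properties
  using (filter-accept; filter-all; filter-notAll; filter-reject; length-++; length-applyUpTo; length-map; length-upTo)
open import Data.List.Relation.Unary.All as All using (All)
open import Data.List.Relation.Unary.All.Properties using (all⁺; all⁻; applyUpTo⁺₁)
import Data.List.Relation.Unary.AllPairs as AllPairs
open import Data.List.Relation.Unary.Any using (any?; here; there)
open import Data.List.Relation.Unary.Any.Properties using (any⁺; any⁻)
open import Data.List.Relation.Unary.Linked as Linked using (Linked)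
open import Data.List.Relation.Unary.Unique.Propositional using (Unique)
open import Data.List.Relation.Unary.Unique.Propositional.Properties using (filter⁺; upTo⁺)
open import Data.Product using (∃-syntax; _×_; _,_; proj₁; proj₂)
open import Data.Sum using (_⊎_; inj₁; inj₂; [_,_]′)
open import Function using (_∘_; id)
open import Function.Bundles using (Equivalence; _⇔_; mk⇔)
open import Relation.Binary.Definitions using (tri<; tri≈; tri>)
open import Relation.Binary.PropositionalEquality
open import Relation.Nullary using (¬_; Dec; yes; no; ¬?; contradiction; _×-dec_)

-- Farkas-style combination: the hypotheses are added up with _⊕_ and the
-- remaining identity is left to the ring solver, so that no subtraction occurs.

private
  variable
    x y A B C D : ℕ

lin : A ≤ B → x + B ≡ y + A → x ≤ y
lin {A} {B} {x} {y} A≤B eq =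
  +-cancelʳ-≤ A x y (≤-trans (+-monoʳ-≤ x A≤B) (≤-reflexive eq))

lin-≡ : A ≡ B → x + B ≡ y + A → x ≡ y
lin-≡ {A} {x = x} {y} refl eq = +-cancelʳ-≡ A x y eq

infixl 5 _⊕_ _⊞_

_⊕_ : A ≤ B → C ≤ D → A + C ≤ B + D
_⊕_ = +-mono-≤

_⊞_ : A ≡ B → C ≡ D → A + C ≡ B + D
_⊞_ = cong₂ _+_

-- Finite sums, downward induction and counting.

Σ< : ℕ → (ℕ → ℕ) → ℕ
Σ< zero    f = 0
Σ< (suc n) f = Σ< n f + f n

Σ<-mono : ∀ n {f g} → (∀ i → i < n → f i ≤ g i) → Σ< n f ≤ Σ< n g
Σ<-mono zero    f≤g = z≤n
Σ<-mono (suc n) f≤g = Σ<-mono n (λ i i<n → f≤g i (m<n⇒m<1+n i<n)) ⊕ f≤g n ≤-refl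

Σ<-head : ∀ n f → Σ< (suc n) f ≡ f 0 + Σ< n (f ∘ suc)
Σ<-head zero    f = +-comm 0 (f 0)
Σ<-head (suc n) f = trans (cong (_+ f (suc n)) (Σ<-head n f)) (+-assoc (f 0) _ _)

Σ<-monoˡ : ∀ {m n} f → m ≤′ n → Σ< m f ≤ Σ< n f
Σ<-monoˡ f ≤′-refl       = ≤-refl
Σ<-monoˡ f (≤′-step m≤n) = m≤n⇒m≤n+o _ (Σ<-monoˡ f m≤n)

+-cancel-≤ˡ : ∀ {a b c d} → a ≤ b → b + c ≤ a + d → c ≤ d
+-cancel-≤ˡ {a} {b} {c} {d} h h′ = lin (h ⊕ h′) (solve (a ∷ b ∷ c ∷ d ∷ []))

+-cancel-≤ʳ : ∀ {a b c d} → a + b ≤ c + d → d ≤ b → a ≤ c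
+-cancel-≤ʳ {a} {b} {c} {d} h h′ = lin (h ⊕ h′) (solve (a ∷ b ∷ c ∷ d ∷ []))

Σ<-squeeze : ∀ n {f g} → (∀ i → i < n → f i ≤ g i) → Σ< n g ≤ Σ< n f →
             ∀ i → i < n → f i ≡ g i
Σ<-squeeze (suc n) {f} {g} f≤g sg≤sf i i<1+n with m≤n⇒m<n∨m≡n (s≤s⁻¹ i<1+n)
... | inj₂ refl = ≤-antisym (f≤g n ≤-refl) (+-cancel-≤ˡ (Σ<-mono n (λ j j<n → f≤g j (m<n⇒m<1+n j<n))) sg≤sf)
... | inj₁ i<n = Σ<-squeeze n (λ j j<n → f≤g j (m<n⇒m<1+n j<n)) (+-cancel-≤ʳ sg≤sf (f≤g n ≤-refl)) i i<n

-- The induction remembers whether an index with `P` has been passed; a second one is impossible, so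
-- the excess never grows beyond one.
Σ<-drop-once : ∀ {f f′ : ℕ → ℕ} (P : ℕ → Set) → (∀ {i j} → P i → P j → i < j → ⊥) →
               (∀ i → f i ≤ f′ i ⊎ (P i × f i ≤ suc (f′ i))) →
               ∀ n → Σ< n f ≤ suc (Σ< n f′)
Σ<-drop-once {f} {f′} P once step n = [ m≤n⇒m≤1+n , proj₂ ]′ (go n)
  where
  go : ∀ n → Σ< n f ≤ Σ< n f′ ⊎ ((∃[ i ] (i < n × P i)) × Σ< n f ≤ suc (Σ< n f′))
  go zero = inj₁ z≤n
  go (suc n) with go n | step n
  ... | inj₁ h | inj₁ h' = inj₁ (h ⊕ h')
  ... | inj₁ h | inj₂ (Pn , h') =
    inj₂ ((n , ≤-refl , Pn) , ≤-trans (h ⊕ h') (≤-reflexive (+-suc _ _)))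
  ... | inj₂ ((i , i<n , Pi) , h) | inj₁ h' = inj₂ ((i , m<n⇒m<1+n i<n , Pi) , (h ⊕ h'))
  ... | inj₂ ((i , i<n , Pi) , h) | inj₂ (Pn , _) = ⊥-elim (once Pi Pn i<n)

-- The recursion of a core refers to higher rows only and everything vanishes far up, so facts about
-- cores are proved from the top row down.
downward : (P : ℕ → Set) (N : ℕ) → (∀ i → N ≤ i → P i) →
           (∀ i → i < N → (∀ j → i < j → P j) → P i) → ∀ i → P i
downward P N base step i = go N i (m≤n+m N i)
  where
  go : ∀ f i → N ≤ i + f → P i
  go zero i N≤i = base i (≤-trans N≤i (≤-reflexive (+-identityʳ i)))
  go (suc f) i N≤i with N ≤? i
  ... | yes p = base i p
  ... | no ¬p = step i (≰⇒> ¬p)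
    (λ j i<j → go f j (≤-trans N≤i (≤-trans (≤-reflexive (+-suc i f)) (+-monoˡ-≤ f i<j))))

antitone-≤ : ∀ {g : ℕ → ℕ} → (∀ i → g (suc i) ≤ g i) → ∀ {i j} → i ≤ j → g j ≤ g i
antitone-≤ {g} anti i≤j = go (≤⇒≤′ i≤j)
  where
  go : ∀ {i j} → i ≤′ j → g j ≤ g i
  go ≤′-refl       = ≤-refl
  go (≤′-step i≤j) = ≤-trans (anti _) (go i≤j)

unique⊆⇒length≤ : {X : Set} (_≟_ : (a b : X) → Dec (a ≡ b)) {xs ys : List X} → Unique xs →
                  (∀ {a} → a ∈ xs → a ∈ ys) → length xs ≤ length ys
unique⊆⇒length≤ _≟_ AllPairs.[] xs⊆ys = z≤n
unique⊆⇒length≤ _≟_ {a ∷ xs} {ys} (a∉xs AllPairs.∷ uniq) xs⊆ys =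
  ≤-trans
    (s≤s (unique⊆⇒length≤ _≟_ uniq λ {b} b∈xs →
      ∈-filter⁺ (λ b → ¬? (a ≟ b)) (xs⊆ys (there b∈xs)) (All.lookup a∉xs b∈xs)))
    (filter-notAll (λ b → ¬? (a ≟ b)) ys (lose (xs⊆ys (here refl)) (λ ¬a≡a → ¬a≡a refl)))

-- Arithmetic modulo `k + 1`.

%-≡ : ∀ k {a b} c d → a + c * suc k ≡ b + d * suc k → a % suc k ≡ b % suc k
%-≡ k {a} {b} c d eq =
  trans (sym ([m+kn]%n≡m%n a c (suc k))) (trans (cong (_% suc k) eq) ([m+kn]%n≡m%n b d (suc k)))

%-+-congʳ : ∀ k {a b} c → a % suc k ≡ b % suc k → (c + a) % suc k ≡ (c + b) % suc k
%-+-congʳ k {a} {b} c eq =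
  trans (%-distribˡ-+ c a (suc k))
    (trans (cong (λ r → (c % suc k + r) % suc k) eq) (sym (%-distribˡ-+ c b (suc k))))

%-+-shift : ∀ k c a → (c + a % suc k) % suc k ≡ (c + a) % suc k
%-+-shift k c a = %-+-congʳ k {a % suc k} {a} c (m%n%n≡m%n a (suc k))

private
  complement : ∀ k a b → k * a + (a + b) + 0 * suc k ≡ b + a * suc k
  complement k a b = solve (k ∷ a ∷ b ∷ [])

-- Adding `k * a` cancels `a`, because `k * a + a` is a multiple of `k + 1`; what remains is `d`,
-- which is already reduced.
<⇒%-≢ : ∀ k a {d} → 0 < d → d < suc k → (a + d) % suc k ≢ a % suc k
<⇒%-≢ k a {d} 0<d d<n eq = n≮0 (subst (0 <_) d≡0 0<d)
  where
  cancel : ∀ b → (k * a + (a + b)) % suc k ≡ b % suc k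
  cancel b = %-≡ k 0 a (complement k a b)
  d≡0 : d ≡ 0
  d≡0 =
    trans (sym (m<n⇒m%n≡m d<n)) (trans (sym (cancel d))
      (trans (%-+-congʳ k {a + d} {a + 0} (k * a)
        (trans eq (cong (_% suc k) (sym (+-identityʳ a))))) (cancel 0)))

-- Cores as solutions of a recursion

up : ℕ → (ℕ → ℕ) → ℕ → ℕ
up k l i = i + (suc k ∸ l i)

-- In a (k+1)-core, row `i` has `g (up k l i)` cells of hook length above `k`; `rec` retains this
-- count and forgets the hooks.
record Core (k : ℕ) (g l : ℕ → ℕ) : Set where
  field
    bounded  : ∀ i → l i ≤ k
    rec      : ∀ i → g i ≡ l i + g (up k l i)
    antitone : ∀ i → g (suc i) ≤ g i
    height   : ℕ
    vanish   : ∀ i → height ≤ i → g i ≡ 0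

  anti-≤ : ∀ {i j} → i ≤ j → g j ≤ g i
  anti-≤ = antitone-≤ antitone

  up-+ : ∀ i → up k l i + l i ≡ i + suc k
  up-+ i = trans (+-assoc i _ _) (cong (i +_) (m∸n+n≡m (m≤n⇒m≤1+n (bounded i))))

  private
    rec-+′ : ∀ {a b u c i n} → a ≡ c + b → u + c ≡ i + n → a + u ≡ b + (i + n)
    rec-+′ {a} {b} {u} {c} {i} {n} e f = lin-≡ (e ⊞ f) (solve (a ∷ b ∷ u ∷ c ∷ i ∷ n ∷ []))

  -- The bead form of `rec`, b_{up i} = b_i - (k + 1), with the negative terms moved across.
  rec-+ : ∀ i → g i + up k l i ≡ g (up k l i) + (i + suc k)
  rec-+ i = rec-+′ {i = i} (rec i) (up-+ i)

  <-up : ∀ i → i < up k l i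
  <-up i = m<m+n i (m<n⇒0<n∸m (s≤s (bounded i)))

  private
    up-mono′ : ∀ {a b c d u v i n} → a + u ≡ b + (i + n) → c + v ≡ d + (suc i + n) →
               c ≤ a → b ≤ d → suc u ≤ v
    up-mono′ {a} {b} {c} {d} {u} {v} {i} {n} e f h h′ =
      lin (≤-reflexive (e ⊞ sym f) ⊕ h ⊕ h′)
        (solve (a ∷ b ∷ c ∷ d ∷ u ∷ v ∷ i ∷ n ∷ []))

  -- The beads strictly decrease, and subtracting k + 1 from b_i and b_{i+1} keeps them in order.
  up-mono : ∀ i → up k l i < up k l (suc i)
  up-mono i with up k l i <? up k l (suc i)
  ... | yes p = p
  ... | no ¬p = up-mono′ {i = i} (rec-+ i) (rec-+ (suc i)) (antitone i) (anti-≤ (≮⇒≥ ¬p))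

  private
    flat′ : ∀ {a b c d u v i n} → a + u ≡ b + (i + n) → c + v ≡ d + (suc i + n) →
            c ≡ a → suc u ≤ v → b ≤ d
    flat′ {a} {b} {c} {d} {u} {v} {i} {n} e f refl h =
      lin (≤-reflexive (sym e ⊞ f) ⊕ h)
        (solve (a ∷ b ∷ d ∷ u ∷ v ∷ i ∷ n ∷ []))

  -- Equal lengths of rows i and i + 1 mean b_{i+1} = b_i - 1, and adjacent beads stay adjacent
  -- after subtracting k + 1.
  up-flat : ∀ {i} → g (suc i) ≡ g i → g (suc (up k l i)) ≡ g (up k l i)
  up-flat {i} flat = ≤-antisym (antitone _)
    (≤-trans (flat′ {i = i} (rec-+ i) (rec-+ (suc i)) flat (up-mono i)) (anti-≤ (up-mono i)))

  -- The residue of the first cell beyond row `i`. It is b_i modulo k + 1, that is, the runner of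
  -- the bead.
  endResidue : ℕ → ℕ
  endResidue i = residue k i (g i)

  private
    endResidue-up′ : ∀ {a b u i} → a + u ≡ b + (i + suc k) →
                     b + k * u + suc i * suc k ≡ a + k * i + u * suc k
    endResidue-up′ {a} {b} {u} {i} e = lin-≡ (sym e) (solve (k ∷ a ∷ b ∷ u ∷ i ∷ []))

  endResidue-up : ∀ i → endResidue (up k l i) ≡ endResidue i
  endResidue-up i = %-≡ k {g u + k * u} {g i + k * i} (suc i) u (endResidue-up′ {g i} {g u} {u} {i} (rec-+ i))
    where u = up k l i

  private
    gap<′ : ∀ {a b c s t i} → t + c ≡ a → a + (suc i + s) < b + (i + suc k) → b ≤ c → t + suc s < suc k
    gap<′ {a} {b} {c} {s} {t} {i} e h h′ =
      lin (≤-reflexive e ⊕ h ⊕ h′) (solve (k ∷ a ∷ b ∷ c ∷ s ∷ t ∷ i ∷ []))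

    gap-≡ : ∀ {a c t} s i → t + c ≡ a →
            c + k * (suc i + s) + (t + suc s) + 0 * suc k ≡ a + k * i + suc s * suc k
    gap-≡ {a} {c} {t} s i e = lin-≡ e (solve (k ∷ a ∷ c ∷ t ∷ s ∷ i ∷ []))

  -- Two beads b_i > b_j (b_i = g i - i) on the same runner are at least k + 1 apart,
  -- and b_{up i} = b_i - (k + 1).
  endResidue-≡⇒up≤ : ∀ {i j} → i < j → endResidue j ≡ endResidue i → up k l i ≤ j
  endResidue-≡⇒up≤ {i} {j} i<j eq with up k l i ≤? j
  ... | yes p = p
  ... | no ¬p with m≤n⇒∃[o]m+o≡n i<j
  ...   | s , refl = contradiction (trans (%-≡ k {g j + k * j + (g i ∸ g j + suc s)} 0 (suc s) (gap-≡ {c = g j} {t = g i ∸ g j} s i t+c≡a)) (sym eq))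
        (<⇒%-≢ k (g j + k * j) (m<n⇒0<n (m<m+n _ z<s)) gap<)
    where
    j<u : suc i + s < up k l i
    j<u = ≰⇒> ¬p
    t+c≡a : g i ∸ g j + g j ≡ g i
    t+c≡a = m∸n+n≡m (anti-≤ (<⇒≤ i<j))
    gap< : (g i ∸ g j) + suc s < suc k
    gap< = gap<′ {i = i} t+c≡a (<-≤-trans (+-monoʳ-< (g i) j<u) (≤-reflexive (rec-+ i)))
             (anti-≤ (<⇒≤ j<u))

  -- Iterating `up` from `i` cannot jump over `j`, by `endResidue-≡⇒up≤`, and `up-flat` carries
  -- flatness along. The argument `f` of `go` bounds the distance left.
  flat-runner : ∀ {i j} → i ≤ j → endResidue j ≡ endResidue i → g (suc i) ≡ g i → g (suc j) ≡ g j
  flat-runner {i} {j} i≤j = go (j ∸ i) i i≤j (≤-reflexive (sym (m+[n∸m]≡n i≤j)))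
    where
    go : ∀ f i → i ≤ j → j ≤ i + f → endResidue j ≡ endResidue i → g (suc i) ≡ g i → g (suc j) ≡ g j
    go f i i≤j j≤i+f eq flat with m≤n⇒m<n∨m≡n i≤j
    ... | inj₂ refl = flat
    go zero i i≤j j≤i+f eq flat | inj₁ i<j =
      contradiction (<-≤-trans i<j j≤i+f) (<-irrefl (sym (+-identityʳ i)))
    go (suc f) i i≤j j≤i+f eq flat | inj₁ i<j =
      go f (up k l i) (endResidue-≡⇒up≤ i<j eq)
        (≤-trans j≤i+f (≤-trans (≤-reflexive (+-suc i f)) (+-monoˡ-≤ f (<-up i))))
        (trans eq (sym (endResidue-up i))) (up-flat flat)

-- Removing the corners of one residue

predIf : {P : Set} → Dec P → ℕ → ℕ
predIf (yes _) = pred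
predIf (no _)  = id

predIf-yes : {P : Set} (P? : Dec P) {x : ℕ} → P → predIf P? x ≡ pred x
predIf-yes (yes _) p = refl
predIf-yes (no ¬p) p = contradiction p ¬p

predIf-no : {P : Set} (P? : Dec P) {x : ℕ} → ¬ P → predIf P? x ≡ x
predIf-no (yes p) ¬p = contradiction p ¬p
predIf-no (no _)  ¬p = refl

predIf-≤ : {P : Set} (P? : Dec P) (x : ℕ) → predIf P? x ≤ x
predIf-≤ (yes _) x = pred[n]≤n
predIf-≤ (no _)  x = ≤-refl

pred-+ˡ : ∀ {a} b → 0 < a → pred (a + b) ≡ pred a + b
pred-+ˡ {suc a} b _ = refl

pred-+ʳ : ∀ a {b} → 0 < b → pred (a + b) ≡ a + pred b
pred-+ʳ a {suc b} _ = cong pred (+-suc a b)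

-- Removal of every removable corner whose residue is ρ; with s the class of ρ + 1,
-- these corners are the ends of the rows i with endResidue i ≡ s.
module Peel {k g l} (1≤k : 1 ≤ k) (core : Core k g l) (s : ℕ) where
  open Core core

  Removable : ℕ → Set
  Removable i = g (suc i) < g i × endResidue i ≡ s

  removable? : ∀ i → Dec (Removable i)
  removable? i = (g (suc i) <? g i) ×-dec (endResidue i ≟ s)

  -- The rows in which the number of small hooks drops.
  Loses : ℕ → Set
  Loses i = Removable i × g (suc (up k l i)) ≡ g (up k l i)

  loses? : ∀ i → Dec (Loses i)
  loses? i = removable? i ×-dec (g (suc (up k l i)) ≟ g (up k l i))

  g′ l′ : ℕ → ℕ
  g′ i = predIf (removable? i) (g i)
  l′ i = predIf (loses? i) (l i)

  g′≤g : ∀ i → g′ i ≤ g i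
  g′≤g i = predIf-≤ (removable? i) (g i)

  -- On a common runner `j` is at or above `up k l i`, so flatness there would propagate to `j`,
  -- which is a corner.
  loses-once : ∀ {i j} → Loses i → Loses j → i < j → ⊥
  loses-once {i} {j} ((_ , eᵢ) , flat) ((corner , eⱼ) , _) i<j =
    <⇒≢ corner (flat-runner (endResidue-≡⇒up≤ i<j eq) (trans eq (sym (endResidue-up i))) flat)
    where
    eq : endResidue j ≡ endResidue i
    eq = trans eⱼ (sym eᵢ)

  -- Row `i + 1` ends one residue lower, and `1 ≤ k` makes that a different residue.
  flat-¬removable : ∀ {i} → endResidue i ≡ s → g (suc i) ≡ g i → ¬ Removable (suc i)
  flat-¬removable {i} eᵢ flat (_ , e) =
    <⇒%-≢ k (g i + k * i) 1≤k ≤-refl (trans (cong (_% suc k) shift) (trans e (sym eᵢ)))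
    where
    shift : g i + k * i + k ≡ g (suc i) + k * suc i
    shift rewrite flat = trans (+-assoc (g i) _ k) (cong (g i +_) (trans (+-comm (k * i) k) (sym (*-suc k i))))

  removable⇒0<l : ∀ {i} → Removable i → 0 < l i
  removable⇒0<l {i} (corner , _) = +-cancelʳ-< (g (up k l i)) 0 (l i)
    (<-≤-trans (≤-<-trans (anti-≤ (<-up i)) corner) (≤-reflexive (rec i)))

  up-pred : ∀ {a b} i → 0 < a → a ≤ k → b ≡ pred a → i + (suc k ∸ b) ≡ suc (i + (suc k ∸ a))
  up-pred {suc a} i _ a≤k refl = trans (cong (i +_) (+-∸-assoc 1 (<⇒≤ a≤k))) (+-suc i _)

  -- Let row `i` be removable and `u = up k l i`, which is on the same runner. If `u` is not flat,
  -- it is removable too and loses the same cell. If it is flat, the part drops instead: the new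
  -- `up` is `u + 1`, a row of the same length that is left alone. If row `i` is not removable,
  -- neither is `u`, since flatness and the runner are inherited.
  rec′ : ∀ i → g′ i ≡ l′ i + g′ (up k l′ i)
  rec′ i with removable? i | g (suc (up k l i)) ≟ g (up k l i)
  ... | yes r | yes flat = begin
    pred (g i)                       ≡⟨ cong pred (rec i) ⟩
    pred (l i + g u)                 ≡⟨ pred-+ˡ (g u) 0<l ⟩
    pred (l i) + g u                 ≡⟨ cong (pred (l i) +_) flat ⟨
    pred (l i) + g (suc u)           ≡⟨ cong (pred (l i) +_) (predIf-no (removable? (suc u)) (flat-¬removable (trans (endResidue-up i) (proj₂ r)) flat)) ⟨
    pred (l i) + g′ (suc u)          ≡⟨ cong (λ v → pred (l i) + g′ v) (up-pred i 0<l (bounded i) refl) ⟨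
    pred (l i) + g′ (i + (suc k ∸ pred (l i))) ∎
    where
    open ≡-Reasoning
    u = up k l i
    0<l = removable⇒0<l r
  ... | yes r | no ¬flat = begin
    pred (g i)          ≡⟨ cong pred (rec i) ⟩
    pred (l i + g u)    ≡⟨ pred-+ʳ (l i) (m<n⇒0<n corner) ⟩
    l i + pred (g u)    ≡⟨ cong (l i +_) (predIf-yes (removable? u) (corner , trans (endResidue-up i) (proj₂ r))) ⟨
    l i + g′ u          ∎
    where
    open ≡-Reasoning
    u = up k l i
    corner = ≤∧≢⇒< (antitone u) ¬flat
  ... | no ¬r | _ = trans (rec i) (cong (l i +_) (sym (predIf-no (removable? (up k l i)) ¬r′)))
    where
    ¬r′ : ¬ Removable (up k l i)
    ¬r′ (corner , e) with g (suc i) ≟ g i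
    ... | yes flat = <⇒≢ corner (up-flat flat)
    ... | no ¬flat = ¬r (≤∧≢⇒< (antitone i) ¬flat , trans (sym (endResidue-up i)) e)

  antitone′ : ∀ i → g′ (suc i) ≤ g′ i
  antitone′ i with removable? i
  ... | yes (corner , _) = ≤-trans (g′≤g (suc i)) (pred-mono-≤ corner)
  ... | no _ = ≤-trans (g′≤g (suc i)) (antitone i)

  core′ : Core k g′ l′
  core′ = record
    { bounded  = λ i → ≤-trans (predIf-≤ (loses? i) (l i)) (bounded i)
    ; rec      = rec′
    ; antitone = antitone′
    ; height   = height
    ; vanish   = λ i h≤i → n≤0⇒n≡0 (≤-trans (g′≤g i) (≤-reflexive (vanish i h≤i)))
    }

  loss : ∀ n → Σ< n l ≤ suc (Σ< n l′)
  loss = Σ<-drop-once Loses loses-once step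
    where
    step : ∀ i → l i ≤ l′ i ⊎ (Loses i × l i ≤ suc (l′ i))
    step i with loses? i
    ... | yes p = inj₂ (p , suc[pred[n]]≥n)
      where
      suc[pred[n]]≥n : ∀ {n} → n ≤ suc (pred n)
      suc[pred[n]]≥n {zero} = z≤n
      suc[pred[n]]≥n {suc n} = ≤-refl
    ... | no _  = inj₁ ≤-refl

  removed : ∀ {i} → Removable i → suc (g′ i) ≡ g i
  removed {i} r@(corner , _) =
    trans (cong suc (predIf-yes (removable? i) r)) (suc-pred (g i) {{>-nonZero (m<n⇒0<n corner)}})

-- The lower bound for the numbers of residues

-- Letters start at 0 here, one below the entries of a `Filling`; outside the shape `τ` is
-- arbitrary.
record Tableau (g : ℕ → ℕ) (τ : ℕ → ℕ → ℕ) (n : ℕ) : Set where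
  field
    row   : ∀ {i j} → suc j < g i → τ i j ≤ τ i (suc j)
    col   : ∀ {i j} → j < g (suc i) → τ i j < τ (suc i) j
    bound : ∀ {i j} → j < g i → τ i j < n

restrict : ∀ {g g′ τ n n′} → Tableau g τ n → (∀ i → g′ i ≤ g i) →
           (∀ {i j} → j < g′ i → τ i j < n′) → Tableau g′ τ n′
restrict t g′≤g bound′ = record
  { row   = λ j<g′ → row (<-≤-trans j<g′ (g′≤g _))
  ; col   = λ j<g′ → col (<-≤-trans j<g′ (g′≤g _))
  ; bound = bound′
  }
  where open Tableau t

core-tail : ∀ {k g l} → Core k g l → Core k (g ∘ suc) (l ∘ suc)
core-tail c = record
  { bounded  = bounded ∘ suc
  ; rec      = rec ∘ suc
  ; antitone = antitone ∘ suc
  ; height   = height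
  ; vanish   = λ i h≤i → vanish (suc i) (m≤n⇒m≤1+n h≤i)
  }
  where open Core c

residue-suc : ∀ k i j → residue k i (suc j) ≡ suc (residue k i j) % suc k
residue-suc k i j = sym (%-+-shift k 1 (j + k * i))

full-residues : ∀ k {Q r} → r ∈ Q → (∀ {r} → r ∈ Q → suc r % suc k ∈ Q) → suc k ≤ length Q
full-residues k {Q} {r} r∈Q closed =
  ≤-trans (≤-reflexive (sym (length-upTo (suc k))))
    (unique⊆⇒length≤ _≟_ (upTo⁺ (suc k)) λ b∈ → subst (_∈ Q) (wrap (∈-upTo⁻ b∈)) (iter _))
  where
  iter : ∀ c → (suc r + c) % suc k ∈ Q
  iter zero = subst (λ x → x % suc k ∈ Q) (sym (+-identityʳ (suc r))) (closed r∈Q)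
  iter (suc c) =
    subst (_∈ Q) (trans (%-+-shift k 1 (suc r + c)) (cong (_% suc k) (sym (+-suc (suc r) c)))) (closed (iter c))
  -- Going from `suc r` to `b` takes `k * suc r + b` steps, as `suc r + k * suc r` is a multiple of
  -- k + 1.
  wrap : ∀ {b} → b < suc k → (suc r + (k * suc r + b)) % suc k ≡ b
  wrap {b} b<n = trans (%-≡ k {suc r + (k * suc r + b)} {b} 0 (suc r) (around r b)) (m<n⇒m%n≡m b<n)
    where
    around : ∀ r b → suc r + (k * suc r + b) + 0 * suc k ≡ b + suc r * suc k
    around r b = solve (k ∷ r ∷ b ∷ [])

Covers : ℕ → (ℕ → List ℕ) → (ℕ → ℕ) → (ℕ → ℕ → ℕ) → Set
Covers k R g τ = ∀ {i j} → j < g i → residue k i j ∈ R (τ i j)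

-- The list `Q` of the largest letter is kept apart from `R`, because it alone shrinks during the
-- peeling.
CoversTop : ℕ → ℕ → (ℕ → List ℕ) → List ℕ → (ℕ → ℕ) → (ℕ → ℕ → ℕ) → Set
CoversTop k n R Q g τ =
  ∀ {i j} → j < g i → (τ i j < n × residue k i j ∈ R (τ i j)) ⊎ (τ i j ≡ n × residue k i j ∈ Q)

LowerBound : ℕ → ℕ → Set
LowerBound k n = ∀ R {g l τ} → Core k g l → Tableau g τ n → Covers k R g τ →
  ∀ N → Σ< N l ≤ Σ< n (length ∘ R)

module _ {k : ℕ} (1≤k : 1 ≤ k) where

  module _ {n : ℕ} (ih : LowerBound k n) where

    -- If r + 1 is not a residue of the letter n, then every cell n of residue r
    -- ends its row and is a removable corner.
    peel-residue : ∀ R {Q g l τ r} → r ∈ Q → suc r % suc k ∉ Q → (core : Core k g l) →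
      Tableau g τ (suc n) → CoversTop k n R Q g τ →
      CoversTop k n R (filter (λ a → ¬? (r ≟ a)) Q) (Peel.g′ 1≤k core (suc r % suc k)) τ
    peel-residue R {Q} {g} {l} {τ} {r} r∈Q sr∉Q core t cov {i} {j} j<g′ with cov (<-≤-trans j<g′ (g′≤g i))
      where open Peel 1≤k core (suc r % suc k)
    ... | inj₁ low = inj₁ low
    ... | inj₂ (τ≡n , res∈Q) = inj₂ (τ≡n , ∈-filter⁺ (λ a → ¬? (r ≟ a)) res∈Q keep)
      where
      open Peel 1≤k core (suc r % suc k)
      open Tableau t
      keep : r ≢ residue k i j
      keep refl with m≤n⇒m<n∨m≡n (<-≤-trans j<g′ (g′≤g i))
      ... | inj₁ sj<g with cov sj<g
      ...   | inj₁ (τ<n , _) = <-irrefl τ≡n (≤-<-trans (row sj<g) τ<n)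
      ...   | inj₂ (_ , res∈Q′) = sr∉Q (subst (_∈ Q) (residue-suc k i j) res∈Q′)
      keep refl | inj₂ sj≡g with suc j ≤? g (suc i)
      ...   | yes j<g⁺ = <-irrefl τ≡n (<-≤-trans (col j<g⁺) (s≤s⁻¹ (bound j<g⁺)))
      ...   | no j≮g⁺ = <-irrefl refl (≤-trans (s≤s j<g′) (≤-reflexive (trans (removed corner) (sym sj≡g))))
        where
        corner : Removable i
        corner = <-≤-trans (≰⇒> j≮g⁺) (≤-reflexive sj≡g) ,
          trans (cong (λ x → (x + k * i) % suc k) (sym sj≡g)) (residue-suc k i j)

    without-top : ∀ R {Q g g′ l′ τ} → Core k g′ l′ → Tableau g τ (suc n) → CoversTop k n R Q g τ →
      (∀ i → g′ i ≤ g i) → (∀ {i j} → j < g′ i → τ i j ≢ n) → ∀ N → Σ< N l′ ≤ Σ< n (length ∘ R)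
    without-top R {Q} {g} {g′} {τ = τ} core′ t cov g′≤g top∉ = ih R core′ (restrict t g′≤g (proj₁ ∘ low)) (proj₂ ∘ low)
      where
      low : ∀ {i j} → j < g′ i → τ i j < n × residue k i j ∈ R (τ i j)
      low {i} j<g′ with cov (<-≤-trans j<g′ (g′≤g i))
      ... | inj₁ h = h
      ... | inj₂ (τ≡n , _) = contradiction τ≡n (top∉ j<g′)

    -- Induction on a bound `f` for the length of `Q`. If some r in `Q` lacks its successor, peeling
    -- costs one element of `Q` and at most one unit of the sum. Otherwise `Q` is empty or consists
    -- of all residues.
    lowerBound-top : ∀ f R {Q g l τ} → length Q ≤ f → Core k g l → Tableau g τ (suc n) →
      CoversTop k n R Q g τ → ∀ N → Σ< N l ≤ Σ< n (length ∘ R) + length Q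
    lowerBound-top f R {Q} {g} {l} {τ} |Q|≤f core t cov N with any? (λ r → ¬? (suc r % suc k ∈? Q)) Q
    lowerBound-top zero R {[]} |Q|≤f core t cov N | yes ()
    lowerBound-top (suc f) R {Q} {g} {l} {τ} |Q|≤f core t cov N | yes p with find p
    ... | r , r∈Q , sr∉Q = begin
      Σ< N l                                 ≤⟨ loss N ⟩
      suc (Σ< N l′)                          ≤⟨ s≤s (lowerBound-top f R (s≤s⁻¹ (≤-trans shorter |Q|≤f)) core′
                                                  (restrict t g′≤g (λ {i} j<g′ → bound (<-≤-trans j<g′ (g′≤g i))))
                                                  (peel-residue R r∈Q sr∉Q core t cov) N) ⟩
      suc (Σ< n (length ∘ R) + length Q′)    ≡⟨ +-suc _ _ ⟨
      Σ< n (length ∘ R) + suc (length Q′)    ≤⟨ +-monoʳ-≤ _ shorter ⟩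
      Σ< n (length ∘ R) + length Q           ∎
      where
      open ≤-Reasoning
      open Peel 1≤k core (suc r % suc k)
      open Tableau t
      Q′ = filter (λ a → ¬? (r ≟ a)) Q
      shorter : length Q′ < length Q
      shorter = filter-notAll (λ a → ¬? (r ≟ a)) Q (lose r∈Q (λ ¬r≡r → ¬r≡r refl))
    lowerBound-top f R {[]} {g} {l} {τ} |Q|≤f core t cov N | no _ =
      m≤n⇒m≤n+o 0 (without-top R core t cov (λ _ → ≤-refl) top∉ N)
      where
      top∉ : ∀ {i j} → j < g i → τ i j ≢ n
      top∉ j<g τ≡n with cov j<g
      ... | inj₁ (τ<n , _) = <-irrefl τ≡n τ<n
      ... | inj₂ (_ , ())
    lowerBound-top f R {Q@(q ∷ _)} {g} {l} {τ} |Q|≤f core t cov N | no ¬p = begin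
      Σ< N l                            ≤⟨ m≤m+n _ (l N) ⟩
      Σ< (suc N) l                      ≡⟨ Σ<-head N l ⟩
      -- The shape moves down one row but the filling stays, so residues do not change. The letter
      -- `n` disappears, because above each remaining cell the old shape has a cell with a larger
      -- letter.
      l 0 + Σ< N (l ∘ suc)              ≤⟨ ≤-trans (m≤n⇒m≤1+n (bounded 0)) full ⊕
                                            without-top R (core-tail core) t cov antitone
                                              (λ j<g⁺ τ≡n → <-irrefl τ≡n (<-≤-trans (col j<g⁺) (s≤s⁻¹ (bound j<g⁺)))) N ⟩
      length Q + Σ< n (length ∘ R)      ≡⟨ +-comm (length Q) _ ⟩
      Σ< n (length ∘ R) + length Q      ∎
      where
      open ≤-Reasoning
      open Core core
      open Tableau t
      closed : ∀ {r} → r ∈ Q → suc r % suc k ∈ Q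
      closed {r} r∈Q with suc r % suc k ∈? Q
      ... | yes h = h
      ... | no h = contradiction (lose r∈Q h) ¬p
      full : suc k ≤ length Q
      full = full-residues k (here refl) closed

  lowerBound : ∀ n → LowerBound k n
  lowerBound zero R {g} {l} core t cov N = ≤-trans (Σ<-mono N l≤0) (≤-reflexive (Σ<-zero N))
    where
    open Core core
    Σ<-zero : ∀ N → Σ< N (λ _ → 0) ≡ 0
    Σ<-zero zero    = refl
    Σ<-zero (suc N) = trans (+-identityʳ _) (Σ<-zero N)
    g≤0 : ∀ i → g i ≤ 0
    g≤0 i with g i in eq
    ... | zero  = z≤n
    ... | suc _ = contradiction (Tableau.bound t {i} (subst (0 <_) (sym eq) z<s)) n≮0
    l≤0 : ∀ i → i < N → l i ≤ 0
    l≤0 i _ = ≤-trans (m≤m+n (l i) _) (≤-trans (≤-reflexive (sym (rec i))) (g≤0 i))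
  lowerBound (suc n) R {g} {l} {τ} core t cov = lowerBound-top (lowerBound n) (length (R n)) R ≤-refl core t cov′
    where
    open Tableau t
    cov′ : CoversTop k n R (R n) g τ
    cov′ {i} {j} j<g with m≤n⇒m<n∨m≡n (s≤s⁻¹ (bound j<g))
    ... | inj₁ τ<n = inj₁ (τ<n , cov j<g)
    ... | inj₂ τ≡n = inj₂ (τ≡n , subst (λ a → residue k i j ∈ R a) τ≡n (cov j<g))

-- Building a tableau by merging rows

at-vanish : ∀ xs {i} → length xs ≤ i → at xs i ≡ 0
at-vanish []       _           = refl
at-vanish (x ∷ xs) (s≤s |xs|≤i) = at-vanish xs |xs|≤i

at-drop : ∀ n xs i → at (drop n xs) i ≡ at xs (n + i)
at-drop zero    xs       i = refl
at-drop (suc n) []       i = refl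
at-drop (suc n) (x ∷ xs) i = at-drop n xs i

-- The rows are found from the top down. The index `k ∸ x` stands for `up` of the current row, one
-- less because the list of the rows above starts one row higher.
coreRows : ℕ → List ℕ → List ℕ
coreRows k []       = []
coreRows k (x ∷ xs) = (x + at (coreRows k xs) (k ∸ x)) ∷ coreRows k xs

coreRows-rec : ∀ k xs → (∀ i → at xs i ≤ k) →
               ∀ i → at (coreRows k xs) i ≡ at xs i + at (coreRows k xs) (up k (at xs) i)
coreRows-rec k []       b i       = refl
coreRows-rec k (x ∷ xs) b zero    =
  cong (λ u → x + at (coreRows k (x ∷ xs)) u) (sym (+-∸-assoc 1 (b 0)))
coreRows-rec k (x ∷ xs) b (suc i) = coreRows-rec k xs (b ∘ suc) i

record Merge (r p : ℕ) (l ν : ℕ → ℕ) : Set where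
  field
    below : ∀ i → i < p → ν i ≡ l i
    merge : ν p + r ≡ l p + l (suc p)
    above : ∀ i → p < i → ν i ≡ l (suc i)
    r≤lₚ  : r ≤ l p
    lₚ₊₁<r : l (suc p) < r

  -- Together with `νₚ≤lₚ` this is the interlacing of the parts of ν and λ that makes 𝔠(λ)/𝔠(ν) a
  -- horizontal strip.
  lₚ₊₁≤νₚ : l (suc p) ≤ ν p
  lₚ₊₁≤νₚ = +-cancel-≤ˡ r≤lₚ (≤-reflexive (trans (sym merge) (+-comm (ν p) r)))

  νₚ≤lₚ : ν p ≤ l p
  νₚ≤lₚ = +-cancel-≤ʳ (≤-reflexive merge) (<⇒≤ lₚ₊₁<r)

  Σ<-below : ∀ i → i ≤ p → Σ< i ν ≡ Σ< i l
  Σ<-below zero    _   = refl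
  Σ<-below (suc i) i<p = cong₂ _+_ (Σ<-below i (<⇒≤ i<p)) (below i i<p)

  private
    step≡ : ∀ {a b c r s} → a + r ≡ s → b ≡ c → a + b + r ≡ s + c
    step≡ {a} {b} {c} {r} refl refl = solve (a ∷ b ∷ r ∷ [])

  Σ<-above : ∀ i → p < i → Σ< i ν + r ≡ Σ< (suc i) l
  Σ<-above (suc i) p<1+i with m≤n⇒m<n∨m≡n (s≤s⁻¹ p<1+i)
  ... | inj₁ p<i  = step≡ {a = Σ< i ν} (Σ<-above i p<i) (above i p<i)
  ... | inj₂ refl = trans (+-assoc (Σ< p ν) _ _)
    (trans (cong₂ _+_ (Σ<-below p ≤-refl) merge) (sym (+-assoc (Σ< p l) _ _)))

mergeRow : ∀ r xs → 0 < r → r ≤ at xs 0 → ∃[ ys ] ∃[ p ] Merge r p (at xs) (at ys)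
mergeRow r [] 0<r r≤0 = contradiction (<-≤-trans 0<r r≤0) n≮0
mergeRow r (x ∷ xs) 0<r r≤x with r ≤? at xs 0
... | yes r≤x′ with mergeRow r xs 0<r r≤x′
...   | ys , p , m = x ∷ ys , suc p , record
        { below  = λ { zero _ → refl ; (suc i) (s≤s i<p) → below i i<p }
        ; merge  = merge
        ; above  = λ { (suc i) (s≤s p<i) → above i p<i }
        ; r≤lₚ   = r≤lₚ
        ; lₚ₊₁<r = lₚ₊₁<r
        }
  where open Merge m
mergeRow r (x ∷ xs) 0<r r≤x | no r≰x′ = (x + at xs 0 ∸ r) ∷ drop 1 xs , 0 , record
  { below  = λ _ ()
  ; merge  = m∸n+n≡m (m≤n⇒m≤n+o (at xs 0) r≤x)
  ; above  = λ { (suc i) _ → at-drop 1 xs i }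
  ; r≤lₚ   = r≤x
  ; lₚ₊₁<r = ≰⇒> r≰x′
  }

-- Horizontal strips and their residues.

module Strip {k g l} (core : Core k g l) where
  open Core core

  part-antitone : ∀ i → l (suc i) ≤ l i
  part-antitone i = lemma (up-+ i) (up-+ (suc i)) (up-mono i)
    where
    lemma : ∀ {u v a b c} → u + a ≡ c → v + b ≡ suc c → suc u ≤ v → b ≤ a
    lemma {u} {v} {a} {b} refl f h =
      lin (≤-reflexive f ⊕ h) (solve (u ∷ v ∷ a ∷ b ∷ []))

  residue-≡ : ∀ i i′ j j′ → j′ + (i + suc k) ≡ j + i′ → residue k i′ j′ ≡ residue k i j
  residue-≡ i i′ j j′ e = %-≡ k {j′ + k * i′} {j + k * i} (suc i) i′ (lemma e)
    where
    lemma : j′ + (i + suc k) ≡ j + i′ → j′ + k * i′ + suc i * suc k ≡ j + k * i + i′ * suc k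
    lemma e = lin-≡ e (solve (k ∷ i ∷ i′ ∷ j ∷ j′ ∷ []))

  -- The condition `g (suc i) ≤ j` selects the cells that top their columns.
  TopsIn : ℕ → List ℕ → Set
  TopsIn p L = ∀ {i j} → p ≤ i → g (suc i) ≤ j → j < g i → residue k i j ∈ L

  -- A cell of row p on the runner of a gap between b_{q+e+1} and b_q, where q = up p, b_i = g i - i:
  -- the gap is a residue from L unless it is one of the e beads in between.
  row-cover : ∀ {p L} → TopsIn (suc p) L → ∀ e → ∃[ M ] (length M ≡ e ×
    (∀ {j} → j < g p → g (suc (up k l p + e)) + (p + suc k) ≤ j + (up k l p + e) →
      residue k p j ∈ M ++ L))
  row-cover {p} {L} tops = go
    where
    q = up k l p
    -- A position strictly between b_{t+1} and b_t is the content of a cell of row t that tops its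
    -- column.
    between : ∀ j t → q ≤ t → g (suc t) + (p + suc k) ≤ j + t → j + t < g t + (p + suc k) →
              residue k p j ∈ L
    between j t q≤t lo hi = subst (_∈ L) (residue-≡ p t j j′ eq)
      (tops {t} {j′} (≤-trans (<-up p) q≤t)
        (+-cancelʳ-≤ (p + suc k) _ _ (≤-trans lo (≤-reflexive (sym eq))))
        (+-cancelʳ-< (p + suc k) _ _ (≤-<-trans (≤-reflexive eq) hi)))
      where
      j′ = j + t ∸ (p + suc k)
      eq : j′ + (p + suc k) ≡ j + t
      eq = m∸n+n≡m {j + t} {p + suc k} (≤-trans (m≤n+m (p + suc k) (g (suc t))) lo)
    go : ∀ e → ∃[ M ] (length M ≡ e ×
      (∀ {j} → j < g p → g (suc (q + e)) + (p + suc k) ≤ j + (q + e) → residue k p j ∈ M ++ L))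
    go zero = [] , refl , λ {j} j<g lo →
      between j (q + 0) (m≤m+n q 0) lo
        (subst (λ t → j + t < g t + (p + suc k)) (sym (+-identityʳ q))
          (<-≤-trans (+-monoˡ-< q j<g) (≤-reflexive (rec-+ p))))
    go (suc e) with go e
    ... | M , |M|≡e , cov = residue k t (g t) ∷ M , cong suc |M|≡e , λ {j} → cov′ {j}
      where
      t = q + suc e
      cov′ : ∀ {j} → j < g p → g (suc t) + (p + suc k) ≤ j + t → residue k p j ∈ residue k t (g t) ∷ (M ++ L)
      -- The position is in the gap below the bead b_t, on the bead, or above it, where the list for
      -- `e` suffices.
      cov′ {j} j<g lo with <-cmp (j + t) (g t + (p + suc k))
      ... | tri< hi _ _ = there (∈-++⁺ʳ M (between j t (m≤m+n q _) lo hi))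
      ... | tri≈ _ eq _ = here (sym (residue-≡ p t j (g t) (sym eq)))
      ... | tri> _ _ hi = there (cov j<g (s≤s⁻¹ (subst₂ (λ a b → suc (g a + (p + suc k)) ≤ b)
              (+-suc q e) (trans (cong (j +_) (+-suc q e)) (+-suc j (q + e))) hi)))

  -- By `row-cover`, row `i` adds one residue for each bead strictly between b_{up i} and b_{up
  -- (i+1)}, and there are `l i ∸ l (suc i)` of these.
  tops-cover : ∀ i → ∃[ L ] (length L ≡ l i × TopsIn i L)
  tops-cover = downward _ height base step
    where
    base : ∀ i → height ≤ i → ∃[ L ] (length L ≡ l i × TopsIn i L)
    base i h≤i = [] , sym (n≤0⇒n≡0 l≤0) , λ i≤i′ _ j<g →
      contradiction (<-≤-trans j<g (≤-reflexive (vanish _ (≤-trans h≤i i≤i′)))) n≮0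
      where
      l≤0 : l i ≤ 0
      l≤0 = ≤-trans (m≤m+n (l i) _) (≤-reflexive (trans (sym (rec i)) (vanish i h≤i)))
    step : ∀ i → i < height → (∀ j → i < j → ∃[ L ] (length L ≡ l j × TopsIn j L)) →
           ∃[ L ] (length L ≡ l i × TopsIn i L)
    step i _ ih with ih (suc i) ≤-refl
    ... | L , |L| , tops with row-cover tops (l i ∸ l (suc i))
    ...   | M , |M| , cov = M ++ L , trans (length-++ M) (trans (cong₂ _+_ |M| |L|) e+l≡l) , tops′
      where
      e = l i ∸ l (suc i)
      e+l≡l : e + l (suc i) ≡ l i
      e+l≡l = m∸n+n≡m (part-antitone i)
      next : ∀ {e b a u v c} → e + b ≡ a → u + a ≡ c → v + b ≡ suc c → suc (u + e) ≡ v
      next {e} {b} {a} {u} {v} refl refl f = lin-≡ (sym f) (solve (e ∷ b ∷ u ∷ v ∷ []))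
      v≡ : suc (up k l i + e) ≡ up k l (suc i)
      v≡ = next {e} {l (suc i)} {l i} {up k l i} e+l≡l (up-+ i) (up-+ (suc i))
      bnd : ∀ {a b t n j} → a + suc t ≡ b + suc n → a ≤ j → b + n ≤ j + t
      bnd {a} {b} {t} {n} {j} f h = lin (≤-reflexive (sym f) ⊕ h) (solve (a ∷ b ∷ j ∷ t ∷ n ∷ []))
      tops′ : TopsIn i (M ++ L)
      tops′ {i′} i≤i′ lo hi with m≤n⇒m<n∨m≡n i≤i′
      ... | inj₁ i<i′ = ∈-++⁺ʳ M (tops i<i′ lo hi)
      ... | inj₂ refl = cov hi (bnd {g (suc i)} {g (suc (up k l i + e))} {t = up k l i + e} (subst (λ v → g (suc i) + v ≡ g v + (suc i + suc k)) (sym v≡) (rec-+ (suc i))) lo)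

module MergeStrip {k g l} (core : Core k g l) {r p} {ν δ : ℕ → ℕ} (mrg : Merge r p l ν)
  (δ-rec : ∀ i → δ i ≡ ν i + δ (up k ν i)) (δ-height : ℕ) (δ-vanish : ∀ i → δ-height ≤ i → δ i ≡ 0) where
  open Core core
  open Strip core
  open Merge mrg

  ν≤l : ∀ i → ν i ≤ l i
  ν≤l i with <-cmp i p
  ... | tri< i<p _ _ = ≤-reflexive (below i i<p)
  ... | tri≈ _ refl _ = νₚ≤lₚ
  ... | tri> _ _ p<i = ≤-trans (≤-reflexive (above i p<i)) (part-antitone i)

  ν-bounded : ∀ i → ν i ≤ k
  ν-bounded i = ≤-trans (ν≤l i) (bounded i)

  up-ν-+ : ∀ i → up k ν i + ν i ≡ i + suc k
  up-ν-+ i = trans (+-assoc i _ _) (cong (i +_) (m∸n+n≡m (m≤n⇒m≤1+n (ν-bounded i))))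

  <-up-ν : ∀ i → i < up k ν i
  <-up-ν i = m<m+n i (m<n⇒0<n∸m (s≤s (ν-bounded i)))

  δ-below : ∀ {i} → i < p → δ i ≡ l i + δ (up k l i)
  δ-below {i} i<p = trans (δ-rec i) (cong (λ a → a + δ (i + (suc k ∸ a))) (below i i<p))

  -- Above row `p` both sides solve the same recursion, shifted by the absorbed row.
  δ-above : ∀ i → p < i → δ i ≡ g (suc i)
  δ-above = downward _ (δ-height ⊔ height) base step
    where
    base : ∀ i → δ-height ⊔ height ≤ i → p < i → δ i ≡ g (suc i)
    base i h≤i _ = trans (δ-vanish i (m⊔n≤o⇒m≤o δ-height height h≤i))
      (sym (vanish (suc i) (m≤n⇒m≤1+n (m⊔n≤o⇒n≤o δ-height height h≤i))))
    step : ∀ i → i < δ-height ⊔ height → (∀ j → i < j → p < j → δ j ≡ g (suc j)) → p < i → δ i ≡ g (suc i)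
    step i _ ih p<i = begin
      δ i                                ≡⟨ δ-rec i ⟩
      ν i + δ (up k ν i)                 ≡⟨ cong (ν i +_) (ih (up k ν i) (<-up-ν i) (<-trans p<i (<-up-ν i))) ⟩
      ν i + g (suc (up k ν i))           ≡⟨ cong (λ a → a + g (suc (i + (suc k ∸ a)))) (above i p<i) ⟩
      l (suc i) + g (up k l (suc i))     ≡⟨ rec (suc i) ⟨
      g (suc i)                          ∎
      where open ≡-Reasoning

  δ-p : δ p ≡ ν p + g (suc (up k ν p))
  δ-p = trans (δ-rec p) (cong (ν p +_) (δ-above _ (<-up-ν p)))

  private
    suc-up≤up : ∀ {w a v b c} → w + a ≡ c → v + b ≡ suc c → b ≤ a → suc w ≤ v
    suc-up≤up {w} {a} {v} {b} refl f h = lin (≤-reflexive (sym f) ⊕ h) (solve (w ∷ a ∷ v ∷ b ∷ []))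

    up≤up : ∀ {u a w b c} → u + a ≡ c → w + b ≡ c → b ≤ a → u ≤ w
    up≤up {u} {a} {w} {b} refl f h = lin (≤-reflexive (sym f) ⊕ h) (solve (u ∷ a ∷ w ∷ b ∷ []))

  -- A smaller part has a higher `up`, where rows are shorter, so both summands of the recursion
  -- compare in the same direction.
  δ≤g : ∀ i → δ i ≤ g i
  δ≤g = downward _ (suc p) (λ i p<i → ≤-trans (≤-reflexive (δ-above i p<i)) (antitone i)) step
    where
    step : ∀ i → i < suc p → (∀ j → i < j → δ j ≤ g j) → δ i ≤ g i
    step i i<1+p ih with m≤n⇒m<n∨m≡n (s≤s⁻¹ i<1+p)
    ... | inj₁ i<p = ≤-trans (≤-reflexive (δ-below i<p))
      (≤-trans (+-monoʳ-≤ (l i) (ih (up k l i) (<-up i))) (≤-reflexive (sym (rec i))))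
    ... | inj₂ refl = ≤-trans (≤-reflexive δ-p)
      (≤-trans (+-mono-≤ νₚ≤lₚ (anti-≤ (m≤n⇒m≤1+n (up≤up (up-+ p) (up-ν-+ p) νₚ≤lₚ))))
        (≤-reflexive (sym (rec p))))

  -- This makes the strip horizontal, and with `δ≤g` it also shows that `δ` is weakly decreasing.
  g⁺≤δ : ∀ i → g (suc i) ≤ δ i
  g⁺≤δ = downward _ (suc p) (λ i p<i → ≤-reflexive (sym (δ-above i p<i))) step
    where
    step : ∀ i → i < suc p → (∀ j → i < j → g (suc j) ≤ δ j) → g (suc i) ≤ δ i
    step i i<1+p ih with m≤n⇒m<n∨m≡n (s≤s⁻¹ i<1+p)
    ... | inj₁ i<p = ≤-trans (≤-reflexive (rec (suc i)))
      (≤-trans (+-mono-≤ (part-antitone i) (≤-trans (anti-≤ (up-mono i)) (ih (up k l i) (<-up i))))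
        (≤-reflexive (sym (δ-below i<p))))
    ... | inj₂ refl = ≤-trans (≤-reflexive (rec (suc p)))
      (≤-trans (+-mono-≤ lₚ₊₁≤νₚ (anti-≤ (suc-up≤up (up-ν-+ p) (up-+ (suc p)) lₚ₊₁≤νₚ)))
        (≤-reflexive (sym δ-p)))

  merged-core : Core k δ ν
  merged-core = record
    { bounded  = ν-bounded
    ; rec      = δ-rec
    ; antitone = λ i → ≤-trans (δ≤g (suc i)) (g⁺≤δ i)
    ; height   = δ-height
    ; vanish   = δ-vanish
    }

  -- Strip cells above row `p` top their columns, which takes l (p+1) residues. Row `p` adds r - l
  -- (p+1) beads, as `up k ν p` lies that far above `up k l p`. Lower rows only repeat residues of
  -- higher ones.
  strip-residues : ∃[ X ] (length X ≡ r × (∀ {i j} → δ i ≤ j → j < g i → residue k i j ∈ X))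
  strip-residues with tops-cover (suc p)
  ... | L , |L| , tops with row-cover tops (r ∸ l (suc p))
  ...   | M , |M| , cov = X , trans (length-++ M) (trans (cong₂ _+_ |M| |L|) e+l≡r) ,
          λ {i} {j} lo hi → all-rows i j lo hi
    where
    X = M ++ L
    e = r ∸ l (suc p)
    e+l≡r : e + l (suc p) ≡ r
    e+l≡r = m∸n+n≡m (<⇒≤ lₚ₊₁<r)
    w≡ : ∀ {e b r a c q w n} → e + b ≡ r → c + r ≡ a + b → q + a ≡ n → w + c ≡ n → w ≡ q + e
    w≡ {e} {b} {_} {a} {c} {q} {w} refl f refl h =
      lin-≡ (sym f ⊞ h) (solve (e ∷ b ∷ a ∷ c ∷ q ∷ w ∷ []))
    bnd : ∀ {d v a w n j} → d ≡ v + a → w + v ≡ n → d ≤ j → a + n ≤ j + w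
    bnd {v = v} {a} {w} {j = j} refl refl h = lin h (solve (v ∷ a ∷ w ∷ j ∷ []))
    w = up k ν p
    w≡q+e : w ≡ up k l p + e
    w≡q+e = w≡ {e} {l (suc p)} {r} {l p} {ν p} {up k l p} {w} e+l≡r merge (up-+ p) (up-ν-+ p)
    all-rows : ∀ i j → δ i ≤ j → j < g i → residue k i j ∈ X
    all-rows = downward _ (suc p)
      (λ i p<i j lo hi → ∈-++⁺ʳ M (tops p<i (≤-trans (g⁺≤δ i) lo) hi)) step
      where
      step : ∀ i → i < suc p → (∀ i′ → i < i′ → ∀ j → δ i′ ≤ j → j < g i′ → residue k i′ j ∈ X) →
             ∀ j → δ i ≤ j → j < g i → residue k i j ∈ X
      step i i<1+p ih j lo hi with m≤n⇒m<n∨m≡n (s≤s⁻¹ i<1+p)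
      ... | inj₂ refl = cov hi (subst (λ v → g (suc v) + (p + suc k) ≤ j + v) w≡q+e
              (bnd {v = ν p} {g (suc w)} {w} δ-p (up-ν-+ p) lo))
      -- Moving `l i` columns to the left and up to row `up k l i` keeps the residue. The cell stays
      -- in the strip, since below row `p` the recursions of `g` and `δ` have the same part.
      ... | inj₁ i<p = subst (_∈ X) (residue-≡ i u j j′ eq) (ih u (<-up i) j′ lo′ hi′)
        where
        u = up k l i
        j′ = j ∸ l i
        lo+ : l i + δ u ≤ j
        lo+ = ≤-trans (≤-reflexive (sym (δ-below i<p))) lo
        j≡ : j′ + l i ≡ j
        j≡ = m∸n+n≡m (≤-trans (m≤m+n (l i) _) lo+)
        swap : ∀ {a b c u n} → a + b ≡ c → u + b ≡ n → a + n ≡ c + u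
        swap {a} {b} {_} {u} refl refl = solve (a ∷ b ∷ u ∷ [])
        eq : j′ + (i + suc k) ≡ j + u
        eq = swap {j′} {l i} {j} {u} j≡ (up-+ i)
        lo′ : δ u ≤ j′
        lo′ = m+n≤o⇒m≤o∸n (δ u) (≤-trans (≤-reflexive (+-comm (δ u) (l i))) lo+)
        hi′ : j′ < g u
        hi′ = +-cancelʳ-< (l i) _ _ (≤-<-trans (≤-reflexive j≡) (<-≤-trans hi (≤-reflexive (trans (rec i) (+-comm (l i) (g u))))))

-- An upper bound for the number of residues of one letter; equality follows when all letters are
-- counted together.
Residues : ℕ → (ℕ → ℕ) → (ℕ → ℕ → ℕ) → ℕ → ℕ → Set
Residues k g τ a n = ∃[ L ] (length L ≡ n × (∀ {i j} → j < g i → τ i j ≡ a → residue k i j ∈ L))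

-- The last letter fills the strip γ / δ obtained by merging two rows of λ.  The merge is chosen so
-- that prefix sums of length > p shrink by μ_m only after one more row of λ has been absorbed.
tableau-exists : ∀ {k} m (μ : ℕ → ℕ) (lam : List ℕ) {g} → Core k g (at lam) →
  (∀ {i j} → i ≤ j → μ j ≤ μ i) → (∀ i → i < m → 0 < μ i) →
  (∀ i → i ≤ m → Σ< i μ ≤ Σ< i (at lam)) → (∀ i → Σ< i (at lam) ≤ Σ< m μ) →
  ∃[ τ ] (Tableau g τ m × (∀ a → a < m → Residues k g τ a (μ a)))
tableau-exists zero μ lam {g} core anti pos dom total = (λ _ _ → 0) , record
  { row   = λ _ → z≤n
  ; col   = λ {i} j<g → contradiction (subst (_ <_) (g≡0 (suc i)) j<g) n≮0
  ; bound = λ {i} j<g → contradiction (subst (_ <_) (g≡0 i) j<g) n≮0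
  } , λ _ ()
  where
  open Core core
  l≡0 : ∀ i → at lam i ≡ 0
  l≡0 i = n≤0⇒n≡0 (≤-trans (m≤n+m _ (Σ< i (at lam))) (total (suc i)))
  g≡0 : ∀ i → g i ≡ 0
  g≡0 = downward _ height vanish (λ i _ ih → trans (rec i) (cong₂ _+_ (l≡0 i) (ih _ (<-up i))))
tableau-exists {k} (suc m) μ lam {g} core anti pos dom total
  with mergeRow (μ m) lam (pos m ≤-refl) (≤-trans (anti z≤n) (dom 1 (s≤s z≤n)))
... | ν , p , mrg = extended
  where
  open Core core
  open Merge mrg
  δ = at (coreRows k ν)
  ν≤k : ∀ i → at ν i ≤ k
  ν≤k i with <-cmp i p
  ... | tri< i<p _ _ = ≤-trans (≤-reflexive (below i i<p)) (bounded i)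
  ... | tri≈ _ refl _ = ≤-trans νₚ≤lₚ (bounded i)
  ... | tri> _ _ p<i = ≤-trans (≤-reflexive (above i p<i)) (bounded (suc i))
  open MergeStrip core mrg (coreRows-rec k ν ν≤k) (length (coreRows k ν)) (λ i → at-vanish (coreRows k ν))

  dom′ : ∀ i → i ≤ m → Σ< i μ ≤ Σ< i (at ν)
  dom′ i i≤m with i ≤? p
  ... | yes i≤p = ≤-trans (dom i (m≤n⇒m≤1+n i≤m)) (≤-reflexive (sym (Σ<-below i i≤p)))
  -- Since `μ m ≤ μ i`, the removed part can be exchanged for the next one, which completes a prefix
  -- of length i + 1.
  ... | no i≰p = +-cancelʳ-≤ (μ m) _ _ (≤-trans (+-monoʳ-≤ (Σ< i μ) (anti i≤m))
                   (≤-trans (dom (suc i) (s≤s i≤m)) (≤-reflexive (sym (Σ<-above i (≰⇒> i≰p))))))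

  total′ : ∀ i → Σ< i (at ν) ≤ Σ< m μ
  -- The prefix is extended past row `p`, where `Σ<-above` applies.
  total′ i = ≤-trans (Σ<-monoˡ (at ν) (≤⇒≤′ (m≤m⊔n i (suc p))))
    (+-cancelʳ-≤ (μ m) _ _
      (≤-trans (≤-reflexive (Σ<-above (i ⊔ suc p) (m≤n⊔m i (suc p)))) (total _)))

  extended : ∃[ τ ] (Tableau g τ (suc m) × (∀ a → a < suc m → Residues k g τ a (μ a)))
  extended with tableau-exists m μ ν merged-core anti (λ i i<m → pos i (m<n⇒m<1+n i<m)) dom′ total′
  ... | τ , t , res = τ⁺ , record { row = row⁺ ; col = col⁺ ; bound = bound⁺ } , res⁺
    where
    open Tableau t
    τ⁺ : ℕ → ℕ → ℕ
    τ⁺ i j with j <? δ i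
    ... | yes _ = τ i j
    ... | no _  = m
    bound⁺ : ∀ {i j} → j < g i → τ⁺ i j < suc m
    bound⁺ {i} {j} _ with j <? δ i
    ... | yes j<δ = m<n⇒m<1+n (bound j<δ)
    ... | no _    = ≤-refl
    row⁺ : ∀ {i j} → suc j < g i → τ⁺ i j ≤ τ⁺ i (suc j)
    row⁺ {i} {j} _ with j <? δ i | suc j <? δ i
    ... | yes _   | yes sj<δ = row sj<δ
    ... | yes j<δ | no _     = <⇒≤ (bound j<δ)
    ... | no j≮δ  | yes sj<δ = contradiction (<-trans ≤-refl sj<δ) j≮δ
    ... | no _    | no _     = ≤-refl
    col⁺ : ∀ {i j} → j < g (suc i) → τ⁺ i j < τ⁺ (suc i) j
    col⁺ {i} {j} j<g with j <? δ i | j <? δ (suc i)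
    ... | yes _   | yes j<δ⁺ = col j<δ⁺
    ... | yes j<δ | no _     = bound j<δ
    ... | no j≮δ  | _        = contradiction (<-≤-trans j<g (g⁺≤δ i)) j≮δ
    res⁺ : ∀ a → a < suc m → Residues k g τ⁺ a (μ a)
    res⁺ a a<1+m with m≤n⇒m<n∨m≡n (s≤s⁻¹ a<1+m)
    res⁺ a a<1+m | inj₁ a<m with res a a<m
    ... | L , |L| , cov = L , |L| , λ {i} {j} → inside i j
      where
      inside : ∀ i j → j < g i → τ⁺ i j ≡ a → residue k i j ∈ L
      inside i j j<g eq with j <? δ i
      ... | yes j<δ = cov j<δ eq
      ... | no _    = contradiction (sym eq) (<⇒≢ a<m)
    res⁺ a a<1+m | inj₂ refl with strip-residues
    ... | X , |X| , cov = X , |X| , λ {i} {j} → outside i j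
      where
      outside : ∀ i j → j < g i → τ⁺ i j ≡ m → residue k i j ∈ X
      outside i j j<g eq with j <? δ i
      ... | yes j<δ = contradiction eq (<⇒≢ (bound j<δ))
      ... | no j≮δ  = cov (≮⇒≥ j≮δ) j<g

-- The core equation from hook lengths

at-antitone : ∀ {xs} → Linked _≥_ xs → ∀ i → at xs (suc i) ≤ at xs i
at-antitone Linked.[]        i       = z≤n
at-antitone Linked.[-]       i       = z≤n
at-antitone (x≥y Linked.∷ _) zero    = x≥y
at-antitone (_ Linked.∷ xs)  (suc i) = at-antitone xs i

at-≤ : ∀ {k xs} → All (_≤ k) xs → ∀ i → at xs i ≤ k
at-≤ All.[]         i       = z≤n
at-≤ (x≤k All.∷ _)  zero    = x≤k
at-≤ (_ All.∷ xs≤k) (suc i) = at-≤ xs≤k i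

at-positive : ∀ {xs} → All (0 <_) xs → ∀ i → i < length xs → 0 < at xs i
at-positive (0<x All.∷ _)  zero    _         = 0<x
at-positive (_ All.∷ 0<xs) (suc i) (s≤s i<n) = at-positive 0<xs i i<n

-- In a weakly decreasing list the entries above `j` form an initial segment; this translates legs
-- into row lengths.
count-above⁺ : ∀ {j} xs → (∀ i → at xs (suc i) ≤ at xs i) →
               ∀ h → j < at xs h → h < length (filter (j <?_) xs)
count-above⁺ {j} (x ∷ xs) anti h j<x with j <? x
... | no j≮x = contradiction (<-≤-trans j<x (antitone-≤ {at (x ∷ xs)} anti {j = h} z≤n)) j≮x
... | yes p rewrite filter-accept (j <?_) {xs = xs} p with h
...   | zero  = z<s
...   | suc h = s≤s (count-above⁺ xs (anti ∘ suc) h j<x)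

count-above⁻ : ∀ {j} xs → (∀ i → at xs (suc i) ≤ at xs i) →
               ∀ h → h < length (filter (j <?_) xs) → j < at xs h
count-above⁻ {j} (x ∷ xs) anti h h< with j <? x
... | no j≮x rewrite filter-reject (j <?_) {xs = xs} j≮x =
  contradiction (<-≤-trans (count-above⁻ xs (anti ∘ suc) h h<) (antitone-≤ {at (x ∷ xs)} anti {j = suc h} z≤n)) j≮x
... | yes p rewrite filter-accept (j <?_) {xs = xs} p with h | h<
...   | zero  | _      = p
...   | suc h | s≤s h< = count-above⁻ xs (anti ∘ suc) h h<

-- A property that persists to the right holds on a final segment whose length is the count. It
-- serves for the small hooks of a row.
count-final : {P : ℕ → Set} (P? : ∀ j → Dec (P j)) (f : ℕ → ℕ) (n : ℕ) →
  (∀ {a b} → a ≤ b → b < n → P (f a) → P (f b)) →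
  let c = length (filter P? (applyUpTo f n)) in
  c ≤ n × (∀ j → j < n → n ≤ j + c → P (f j)) × (∀ j → j + c < n → ¬ P (f j))
count-final P? f zero    closed = z≤n , (λ _ ()) , (λ _ ())
count-final {P} P? f (suc n) closed with P? (f 0)
... | yes p₀ rewrite filter-all P? (applyUpTo⁺₁ (f ∘ suc) n (λ i<n → closed z≤n (s≤s i<n) p₀))
                   | length-applyUpTo (f ∘ suc) n =
  ≤-refl , (λ j j<n _ → closed z≤n j<n p₀) , λ j j+n<n _ → <-irrefl refl (≤-<-trans (m≤n+m _ j) j+n<n)
... | no ¬p₀ with count-final P? (f ∘ suc) n (λ a≤b b<n → closed (s≤s a≤b) (s≤s b<n))
...   | c≤n , small , big = m≤n⇒m≤1+n c≤n ,
        (λ { zero _ n<c → contradiction (<-≤-trans n<c c≤n) (<-irrefl refl)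
           ; (suc j) (s≤s j<n) (s≤s n≤) → small j j<n n≤ }) ,
        (λ { zero _ → ¬p₀ ; (suc j) (s≤s lt) → big j lt })

module HookCore {k lam γ} (γ-part : IsPartition γ) (γ-core : IsCore k γ)
  (small : ∀ i → smallHooks k γ i ≡ at lam i) (lam≤k : ∀ i → at lam i ≤ k) where

  private
    g = at γ
    l = at lam

  anti : ∀ i → g (suc i) ≤ g i
  anti = at-antitone (proj₁ γ-part)

  anti-drop : ∀ n i → at (drop n γ) (suc i) ≤ at (drop n γ) i
  anti-drop n i = subst₂ _≤_
    (trans (cong g (sym (+-suc n i))) (sym (at-drop n γ (suc i)))) (sym (at-drop n γ i)) (anti (n + i))

  leg⁺ : ∀ i j h → j < g (suc i + h) → h < leg γ i j
  leg⁺ i j h lt = count-above⁺ (drop (suc i) γ) (anti-drop (suc i)) h (subst (j <_) (sym (at-drop (suc i) γ h)) lt)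

  leg⁻ : ∀ i j h → h < leg γ i j → j < g (suc i + h)
  leg⁻ i j h lt = subst (j <_) (at-drop (suc i) γ h) (count-above⁻ (drop (suc i) γ) (anti-drop (suc i)) h lt)

  hook-antitone : ∀ i {a b} → a ≤ b → hook γ i b ≤ hook γ i a
  hook-antitone i {a} {b} a≤b = +-monoˡ-≤ 1 (+-mono-≤ (∸-monoʳ-≤ (g i) (s≤s a≤b)) legs)
    where
    legs : leg γ i b ≤ leg γ i a
    legs with leg γ i b ≤? leg γ i a
    ... | yes p = p
    ... | no ¬p = contradiction (leg⁺ i a _ (≤-<-trans a≤b (leg⁻ i b _ (≰⇒> ¬p)))) (<-irrefl refl)

  module _ (i : ℕ) where
    rowCount : l i ≤ g i × (∀ j → j < g i → g i ≤ j + l i → hook γ i j ≤ k) × (∀ j → j + l i < g i → ¬ hook γ i j ≤ k)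
    rowCount = subst (λ c → c ≤ g i × (∀ j → j < g i → g i ≤ j + c → hook γ i j ≤ k) × (∀ j → j + c < g i → ¬ hook γ i j ≤ k))
      (small i) (count-final (λ j → hook γ i j ≤? k) id (g i) (λ a≤b _ h → ≤-trans (hook-antitone i a≤b) h))

    big+l : g i ∸ l i + l i ≡ g i
    big+l = m∸n+n≡m (proj₁ rowCount)

    up-≡ : up k l i ≡ suc i + (k ∸ l i)
    up-≡ = trans (cong (i +_) (+-∸-assoc 1 (lam≤k i))) (+-suc i _)

    arm : ∀ {s l g} → s + suc l ≡ g → g ∸ suc s ≡ l
    arm {s} {l} refl = trans (cong (_∸ suc s) (+-suc s l)) (m+n∸m≡n s l)

    -- The first cell `s` with a small hook has arm l i - 1. If row `up k l i` reached column `s`,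
    -- the leg would be at least k + 1 - l i and the hook at least k + 1.
    up≤big : g (up k l i) ≤ g i ∸ l i
    up≤big with l i ≟ 0 | g (up k l i) ≤? g i ∸ l i
    ... | _ | yes p = p
    ... | yes l≡0 | no _ = ≤-trans (antitone-≤ {g} anti (m≤m+n i _)) (≤-reflexive (cong (g i ∸_) (sym l≡0)))
    ... | no l≢0 | no ¬p = contradiction (leg⁺ i s (k ∸ l i) (subst (λ u → s < g u) up-≡ (≰⇒> ¬p))) (≤⇒≯ leg≤)
      where
      m = pred (l i)
      eq : l i ≡ suc m
      eq = sym (suc-pred (l i) {{≢-nonZero l≢0}})
      s = g i ∸ l i
      s+ : s + suc m ≡ g i
      s+ = trans (cong (s +_) (sym eq)) big+l
      s< : s < g i
      s< = <-≤-trans (m<m+n s z<s) (≤-reflexive s+)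
      hook≤ : hook γ i s ≤ k
      hook≤ = proj₁ (proj₂ rowCount) s s< (≤-reflexive (sym big+l))
      leg≤ : leg γ i s ≤ k ∸ l i
      leg≤ = m+n≤o⇒m≤o∸n (leg γ i s) (≤-trans (≤-reflexive (reorder (leg γ i s) (arm s+) eq)) hook≤)
        where
        reorder : ∀ {a b m} c → a ≡ m → b ≡ suc m → c + b ≡ a + c + 1
        reorder {m = m} c refl refl = solve (m ∷ c ∷ [])

    -- The last cell with a large hook has arm `l i`. In a core its hook is not k + 1, so it is at
    -- least k + 2; hence the leg exceeds k - l i and reaches row `up k l i`.
    big≤up : g i ∸ l i ≤ g (up k l i)
    big≤up with g i ∸ l i in eq
    ... | zero  = z≤n
    ... | suc j = subst (λ u → j < g u) (sym up-≡) (leg⁻ i j (k ∸ l i) leg>)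
      where
      j+ : j + suc (l i) ≡ g i
      j+ = trans (+-suc j (l i)) (trans (cong (_+ l i) (sym eq)) big+l)
      j< : j < g i
      j< = <-≤-trans (m<m+n j z<s) (≤-reflexive j+)
      hook> : suc k < hook γ i j
      hook> = ≤∧≢⇒< (≰⇒> (proj₂ (proj₂ rowCount) j (<-≤-trans (+-monoʳ-< j ≤-refl) (≤-reflexive j+)))) (γ-core i j j< ∘ sym)
      leg> : k ∸ l i < leg γ i j
      leg> = lemma (m∸n+n≡m (lam≤k i)) (arm j+) hook>
        where
        lemma : ∀ {d b k a c} → d + b ≡ k → a ≡ b → suc k < a + c + 1 → d < c
        lemma {d} {b} {c = c} refl refl h = lin h (solve (d ∷ b ∷ c ∷ []))

  core : Core k g l
  core = record
    { bounded  = lam≤k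
    ; rec      = λ i → sym (trans (cong (l i +_) (≤-antisym (up≤big i) (big≤up i))) (trans (+-comm (l i) _) (big+l i)))
    ; antitone = anti
    ; height   = length γ
    ; vanish   = λ i → at-vanish γ
    }

-- Fillings

concatMap∷⁺ : {X : Set} {a : X} {w : List X} {as : List X} {ws : List (List X)} →
  a ∈ as → w ∈ ws → a ∷ w ∈ concatMap (λ a → map (a ∷_) ws) as
concatMap∷⁺ {ws = ws} a∈ w∈ = ∈-concatMap⁺ (λ a → map (a ∷_) ws) (lose a∈ (∈-map⁺ (_ ∷_) w∈))

concatMap∷⁻ : {X : Set} {v : List X} (as : List X) (ws : List (List X)) →
  v ∈ concatMap (λ a → map (a ∷_) ws) as → ∃[ a ] ∃[ w ] (a ∈ as × w ∈ ws × v ≡ a ∷ w)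
concatMap∷⁻ as ws v∈ with find (∈-concatMap⁻ (λ a → map (a ∷_) ws) {xs = as} v∈)
... | a , a∈ , v∈map with ∈-map⁻ (a ∷_) v∈map
...   | w , w∈ , eq = a , w , a∈ , w∈ , eq

at-applyUpTo : ∀ f {n j} → j < n → at (applyUpTo f n) j ≡ f j
at-applyUpTo f {suc n} {zero}  _         = refl
at-applyUpTo f {suc n} {suc j} (s≤s j<n) = at-applyUpTo (f ∘ suc) j<n

words⁺ : ∀ m n f → (∀ {j} → j < m → f j < n) → applyUpTo (suc ∘ f) m ∈ words m n
words⁺ zero    n f f<n = here refl
words⁺ (suc m) n f f<n = concatMap∷⁺ (∈-applyUpTo⁺ suc (f<n z<s)) (words⁺ m n (f ∘ suc) (λ j<m → f<n (s≤s j<m)))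

words⁻ : ∀ m n {w} → w ∈ words m n → length w ≡ m × (∀ {j} → j < m → at w j ≤ n)
words⁻ zero    n (here refl) = refl , λ ()
words⁻ (suc m) n w∈ with concatMap∷⁻ (applyUpTo suc n) (words m n) w∈
... | a , w , a∈ , w∈′ , refl with words⁻ m n w∈′ | ∈-applyUpTo⁻ suc a∈
...   | |w| , w≤n | b , b<n , refl = cong suc |w| , λ { {zero} _ → b<n ; {suc j} (s≤s j<m) → w≤n j<m }

words-positive : ∀ m n {w} → w ∈ words m n → ∀ {j} → j < m → 0 < at w j
words-positive (suc m) n w∈ j<m with concatMap∷⁻ (applyUpTo suc n) (words m n) w∈
... | a , w , a∈ , w∈′ , refl with ∈-applyUpTo⁻ suc a∈
words-positive (suc m) n w∈ {zero}  _         | a , w , a∈ , w∈′ , refl | b , _ , refl = z<s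
words-positive (suc m) n w∈ {suc j} (s≤s j<m) | a , w , a∈ , w∈′ , refl | _ = words-positive m n w∈′ j<m

fill : List ℕ → (ℕ → ℕ → ℕ) → Filling
fill []      τ = []
fill (r ∷ γ) τ = applyUpTo (suc ∘ τ 0) r ∷ fill γ (τ ∘ suc)

fillings⁺ : ∀ γ n τ → (∀ {i j} → j < at γ i → τ i j < n) → fill γ τ ∈ fillings γ n
fillings⁺ []      n τ τ<n = here refl
fillings⁺ (r ∷ γ) n τ τ<n = concatMap∷⁺ (words⁺ r n (τ 0) τ<n) (fillings⁺ γ n (τ ∘ suc) (λ {i} → τ<n {suc i}))

entry-fill : ∀ γ τ i {j} → j < at γ i → entry (fill γ τ) i j ≡ suc (τ i j)
entry-fill (r ∷ γ) τ zero    j<r = at-applyUpTo (suc ∘ τ 0) j<r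
entry-fill (r ∷ γ) τ (suc i) j<r = entry-fill γ (τ ∘ suc) i j<r

record HasShape (γ : List ℕ) (n : ℕ) (t : Filling) : Set where
  field
    rows     : length t ≡ length γ
    rowLen   : ∀ i → length (rowOf t i) ≡ at γ i
    positive : ∀ {i j} → j < at γ i → 0 < entry t i j
    entry≤   : ∀ {i j} → j < at γ i → entry t i j ≤ n

fillings⁻ : ∀ γ n {t} → t ∈ fillings γ n → HasShape γ n t
fillings⁻ []      n (here refl) = record { rows = refl ; rowLen = λ _ → refl ; positive = λ () ; entry≤ = λ () }
fillings⁻ (r ∷ γ) n t∈ with concatMap∷⁻ (words r n) (fillings γ n) t∈
... | w , t , w∈ , t∈′ , refl with words⁻ r n w∈ | fillings⁻ γ n t∈′
...   | |w| , w≤n | shape = record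
  { rows     = cong suc rows
  ; rowLen   = λ { zero → |w| ; (suc i) → rowLen i }
  ; positive = λ { {zero} → words-positive r n w∈ ; {suc i} → positive }
  ; entry≤   = λ { {zero} → w≤n ; {suc i} → entry≤ }
  }
  where open HasShape shape

-- The Boolean tests and the residue counts.

rowWeak⁻ : ∀ r → T (rowWeak r) → ∀ {j} → suc j < length r → at r j ≤ at r (suc j)
rowWeak⁻ (x ∷ [])     _ (s≤s ())
rowWeak⁻ (x ∷ y ∷ xs) h {zero}  _         = ≤ᵇ⇒≤ x y (proj₁ (Equivalence.to T-∧ h))
rowWeak⁻ (x ∷ y ∷ xs) h {suc j} (s≤s j<n) = rowWeak⁻ (y ∷ xs) (proj₂ (Equivalence.to (T-∧ {x ≤ᵇ y}) h)) j<n

rowWeak⁺ : ∀ r → (∀ {j} → suc j < length r → at r j ≤ at r (suc j)) → T (rowWeak r)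
rowWeak⁺ []           _ = _
rowWeak⁺ (x ∷ [])     _ = _
rowWeak⁺ (x ∷ y ∷ xs) h = Equivalence.from T-∧ (≤⇒≤ᵇ (h {0} (s≤s (s≤s z≤n))) , rowWeak⁺ (y ∷ xs) (λ j<n → h (s≤s j<n)))

allRows⁻ : ∀ (p : List ℕ → Bool) t → T (p []) → T (all p t) → ∀ i → T (p (rowOf t i))
allRows⁻ p []      p[] _ i       = p[]
allRows⁻ p (r ∷ t) p[] h zero    = proj₁ (Equivalence.to T-∧ h)
allRows⁻ p (r ∷ t) p[] h (suc i) = allRows⁻ p t p[] (proj₂ (Equivalence.to (T-∧ {p r}) h)) i

allRows⁺ : ∀ (p : List ℕ → Bool) t → (∀ i → T (p (rowOf t i))) → T (all p t)
allRows⁺ p []      h = _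
allRows⁺ p (r ∷ t) h = Equivalence.from T-∧ (h 0 , allRows⁺ p t (h ∘ suc))

allUpTo⁻ : ∀ p n → T (all p (upTo n)) → ∀ {i} → i < n → T (p i)
allUpTo⁻ p n h i<n = All.lookup (all⁺ p (upTo n) h) (∈-upTo⁺ i<n)

allUpTo⁺ : ∀ p n → (∀ {i} → i < n → T (p i)) → T (all p (upTo n))
allUpTo⁺ p n h = all⁻ p {upTo n} (All.tabulate (λ i∈ → h (∈-upTo⁻ i∈)))

cells⁺ : ∀ t {i j} → i < length t → j < length (rowOf t i) → (i , j) ∈ cells t
cells⁺ t {i} i< j< = ∈-concatMap⁺ (λ i → map (i ,_) (upTo (length (rowOf t i))))
  (lose (∈-upTo⁺ i<) (∈-map⁺ (i ,_) (∈-upTo⁺ j<)))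

cells⁻ : ∀ t {c} → c ∈ cells t → proj₂ c < length (rowOf t (proj₁ c))
cells⁻ t c∈ with find (∈-concatMap⁻ (λ i → map (i ,_) (upTo (length (rowOf t i)))) {xs = upTo (length t)} c∈)
... | i , _ , c∈row with ∈-map⁻ (i ,_) c∈row
...   | j , j∈ , refl = ∈-upTo⁻ j∈

hasResidue : ℕ → Filling → ℕ → ℕ → Bool
hasResidue k t a r = any (λ c → (entry t (proj₁ c) (proj₂ c) ≡ᵇ a) ∧ (residue k (proj₁ c) (proj₂ c) ≡ᵇ r)) (cells t)

residues : ℕ → Filling → ℕ → List ℕ
residues k t a = filter (λ r → T? (hasResidue k t a r)) (upTo (suc k))

module _ {γ n t} (shape : HasShape γ n t) where
  open HasShape shape

  row< : ∀ {i j} → j < at γ i → i < length t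
  row< {i} j<γ with i <? length t
  ... | yes p = p
  ... | no ¬p = contradiction (<-≤-trans j<γ (≤-reflexive (at-vanish γ (≤-trans (≤-reflexive (sym rows)) (≮⇒≥ ¬p))))) n≮0

  residues⁺ : ∀ k {i j} → j < at γ i → residue k i j ∈ residues k t (entry t i j)
  residues⁺ k {i} {j} j<γ = ∈-filter⁺ (λ r → T? (hasResidue k t (entry t i j) r)) (∈-upTo⁺ (m%n<n (j + k * i) (suc k)))
    (any⁺ _ (lose (cells⁺ t (row< j<γ) (<-≤-trans j<γ (≤-reflexive (sym (rowLen i)))))
      (Equivalence.from T-∧ (≡⇒≡ᵇ (entry t i j) _ refl , ≡⇒≡ᵇ (residue k i j) _ refl))))

  residues⁻ : ∀ k {a r} → r ∈ residues k t a → ∃[ i ] ∃[ j ] (j < at γ i × entry t i j ≡ a × residue k i j ≡ r)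
  residues⁻ k {a} {r} r∈ with find (any⁻ _ (cells t) (proj₂ (∈-filter⁻ (λ r → T? (hasResidue k t a r)) {xs = upTo (suc k)} r∈)))
  ... | (i , j) , c∈ , h with Equivalence.to (T-∧ {entry t i j ≡ᵇ a}) h
  ...   | e , e′ = i , j , <-≤-trans (cells⁻ t c∈) (≤-reflexive (rowLen i)) , ≡ᵇ⇒≡ _ _ e , ≡ᵇ⇒≡ _ _ e′

record Semistandard (γ : List ℕ) (t : Filling) : Set where
  field
    row : ∀ {i j} → suc j < at γ i → entry t i j ≤ entry t i (suc j)
    col : ∀ {i j} → j < at γ (suc i) → entry t i j < entry t (suc i) j

isKTableau⁻ : ∀ {k α γ n t} → HasShape γ n t → T (isKTableau k α t) →
  (∀ i → at γ (suc i) ≤ at γ i) → Semistandard γ t × (∀ a → a < length α → resCount k t (suc a) ≡ at α a)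
isKTableau⁻ {k} {α} {γ} {n} {t} shape h anti with Equivalence.to (T-∧ {all rowWeak t}) h
... | rw , h′ with Equivalence.to (T-∧ {colStrict t}) h′
...   | cs , kw = record { row = row ; col = col } ,
        λ a a<α → ≡ᵇ⇒≡ _ _ (allUpTo⁻ (λ a → resCount k t (suc a) ≡ᵇ at α a) (length α) kw a<α)
  where
  open HasShape shape
  row : ∀ {i j} → suc j < at γ i → entry t i j ≤ entry t i (suc j)
  row {i} sj<γ = rowWeak⁻ (rowOf t i) (allRows⁻ rowWeak t _ rw i) (<-≤-trans sj<γ (≤-reflexive (sym (rowLen i))))
  col : ∀ {i j} → j < at γ (suc i) → entry t i j < entry t (suc i) j
  col {i} {j} j<γ = <ᵇ⇒< _ _ (allUpTo⁻ (λ j → entry t i j <ᵇ entry t (suc i) j) (length (rowOf t (suc i)))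
    (allUpTo⁻ (λ i → all (λ j → entry t i j <ᵇ entry t (suc i) j) (upTo (length (rowOf t (suc i))))) (length t) cs
      (row< shape (<-≤-trans j<γ (anti i))))
    (<-≤-trans j<γ (≤-reflexive (sym (rowLen (suc i))))))

isKTableau⁺ : ∀ {k α γ n t} → HasShape γ n t → Semistandard γ t →
  (∀ a → a < length α → resCount k t (suc a) ≡ at α a) → T (isKTableau k α t)
isKTableau⁺ {k} {α} {γ} {n} {t} shape ss weight = Equivalence.from T-∧ (rw , Equivalence.from T-∧ (cs , kw))
  where
  open HasShape shape
  open Semistandard ss
  rw : T (all rowWeak t)
  rw = allRows⁺ rowWeak t (λ i → rowWeak⁺ (rowOf t i) (λ sj< → row (<-≤-trans sj< (≤-reflexive (rowLen i)))))
  cs : T (colStrict t)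
  cs = allUpTo⁺ (λ i → all (λ j → entry t i j <ᵇ entry t (suc i) j) (upTo (length (rowOf t (suc i))))) (length t)
    (λ {i} _ → allUpTo⁺ (λ j → entry t i j <ᵇ entry t (suc i) j) (length (rowOf t (suc i)))
      (λ j< → <⇒<ᵇ (col (<-≤-trans j< (≤-reflexive (rowLen (suc i)))))))
  kw : T (kWeightOK k α t)
  kw = allUpTo⁺ (λ a → resCount k t (suc a) ≡ᵇ at α a) (length α) (λ {a} a<α → ≡⇒≡ᵇ _ _ (weight a a<α))

filter-nonempty : {X : Set} {P : X → Set} (P? : ∀ a → Dec (P a)) (xs : List X) →
  length (filter P? xs) ≢ 0 → ∃[ a ] (a ∈ xs × P a)
filter-nonempty P? xs ≢0 with filter P? xs in eq
... | []     = contradiction refl ≢0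
... | a ∷ as = a , ∈-filter⁻ P? {xs = xs} (subst (a ∈_) (sym eq) (here refl))

-- Dominance

Σ<-at : ∀ {n} xs → length xs ≤ n → Σ< n (at xs) ≡ sum xs
Σ<-at {zero}  []       _ = refl
Σ<-at {suc n} []       _ = trans (+-identityʳ _) (Σ<-at {n} [] z≤n)
Σ<-at {suc n} (x ∷ xs) (s≤s |xs|≤n) = trans (Σ<-head n (at (x ∷ xs))) (cong (x +_) (Σ<-at xs |xs|≤n))

Σ<-take : ∀ i xs → Σ< i (at xs) ≡ sum (take i xs)
Σ<-take zero    xs       = refl
Σ<-take (suc i) []       = trans (+-identityʳ _) (Σ<-at {i} [] z≤n)
Σ<-take (suc i) (x ∷ xs) = trans (Σ<-head i (at (x ∷ xs))) (cong (x +_) (Σ<-take i xs))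

Σ<-split : ∀ m n f → Σ< (m + n) f ≡ Σ< m f + Σ< n (λ i → f (m + i))
Σ<-split m zero    f = trans (cong (λ x → Σ< x f) (+-identityʳ m)) (sym (+-identityʳ _))
Σ<-split m (suc n) f = trans (cong (λ x → Σ< x f) (+-suc m n))
  (trans (cong (_+ f (m + n)) (Σ<-split m n f)) (+-assoc (Σ< m f) _ _))

Σ<-at-split : ∀ xs i n → length xs ≤ i + n → Σ< i (at xs) + Σ< n (λ x → at xs (i + x)) ≡ sum xs
Σ<-at-split xs i n |xs|≤ = trans (sym (Σ<-split i n (at xs))) (Σ<-at xs |xs|≤)

core-drop : ∀ {k g l} i → Core k g l → Core k (λ x → g (i + x)) (λ x → l (i + x))
core-drop zero    core = core
core-drop (suc i) core = core-drop i (core-tail core)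

-- The two implications of the theorem.

module _ {k γ lam n t} (1≤k : 1 ≤ k) (core : Core k (at γ) (at lam))
  (shape : HasShape γ n t) (ss : Semistandard γ t) where
  open HasShape shape
  open Semistandard ss

  row<entry : ∀ i {j} → j < at γ i → i < entry t i j
  row<entry zero    j<γ = positive j<γ
  row<entry (suc i) j<γ = ≤-<-trans (row<entry i (<-≤-trans j<γ (Core.antitone core i))) (col j<γ)

  -- The rows ≥ i only contain letters > i.
  tail-bound : ∀ i N → Σ< N (λ x → at lam (i + x)) ≤ Σ< (n ∸ i) (λ a → resCount k t (suc (i + a)))
  tail-bound i N = ≤-trans (lowerBound 1≤k (n ∸ i) R (core-drop i core) tableau covers N)
    (Σ<-mono (n ∸ i) (λ a _ → ≤-reflexive (length-map shift (residues k t (suc (i + a))))))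
    where
    τ : ℕ → ℕ → ℕ
    τ x j = entry t (i + x) j ∸ suc i
    -- Dropping the lowest `i` rows raises every content by `i`.
    shift : ℕ → ℕ
    shift r = (i + r) % suc k
    R : ℕ → List ℕ
    R a = map shift (residues k t (suc (i + a)))
    i<entry : ∀ x {j} → j < at γ (i + x) → i < entry t (i + x) j
    i<entry x j<γ = ≤-<-trans (m≤m+n i x) (row<entry (i + x) j<γ)
    tableau : Tableau (λ x → at γ (i + x)) τ (n ∸ i)
    tableau = record
      { row   = λ {x} sj<γ → ∸-monoˡ-≤ (suc i) (row sj<γ)
      ; col   = λ {x} {j} j<γ → subst (λ y → τ x j < entry t y j ∸ suc i) (sym (+-suc i x))
                  (∸-monoˡ-< (col (subst (λ y → j < at γ y) (+-suc i x) j<γ))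
                    (i<entry x (<-≤-trans j<γ (Core.antitone (core-drop i core) x))))
      ; bound = λ {x} j<γ → ≤-trans (≤-reflexive (sym (+-∸-assoc 1 (i<entry x j<γ)))) (∸-monoˡ-≤ i (entry≤ j<γ))
      }
    residue-shift : ∀ x j → shift (residue k (i + x) j) ≡ residue k x j
    residue-shift x j = trans (%-+-shift k i (j + k * (i + x))) (%-≡ k {i + (j + k * (i + x))} {j + k * x} 0 i (wrap i x j))
      where
      wrap : ∀ i x j → i + (j + k * (i + x)) + 0 * suc k ≡ j + k * x + i * suc k
      wrap i x j = solve (k ∷ i ∷ x ∷ j ∷ [])
    covers : Covers k R (λ x → at γ (i + x)) τ
    covers {x} {j} j<γ = subst₂ (λ r a → r ∈ map shift (residues k t a)) (residue-shift x j)
      (sym (m+[n∸m]≡n (i<entry x j<γ))) (∈-map⁺ shift (residues⁺ shape k j<γ))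

module _ {k γ lam mu} (1≤k : 1 ≤ k) (core : Core k (at γ) (at lam)) (|lam|≡|mu| : sum lam ≡ sum mu) where

  -- The sums of both partitions agree, so an inequality between tails is the reverse inequality
  -- between prefixes.
  kKostka≢0⇒⊴ : kKostka k γ mu ≢ 0 → mu ⊴ lam
  kKostka≢0⇒⊴ ≢0 i with filter-nonempty (λ t → T? (isKTableau k mu t)) (fillings γ (length mu)) ≢0
  ... | t , t∈ , isK with fillings⁻ γ (length mu) t∈
  ...   | shape with isKTableau⁻ {k} {mu} shape isK (Core.antitone core)
  ...     | ss , weight = subst₂ _≤_ (Σ<-take i mu) (Σ<-take i lam)
              (+-cancel-≤ʳ (≤-reflexive totals) tails)
    where
    m = length mu ∸ i
    N = length lam
    totals : Σ< i (at mu) + Σ< m (λ a → at mu (i + a)) ≡ Σ< i (at lam) + Σ< N (λ x → at lam (i + x))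
    totals = trans (Σ<-at-split mu i m (m≤n+m∸n (length mu) i))
      (trans (sym |lam|≡|mu|) (sym (Σ<-at-split lam i N (m≤n+m N i))))
    in-range : ∀ {a} → a < m → i + a < length mu
    in-range {a} a<m = ≤-trans (≤-reflexive (sym (+-suc i a)))
      (≤-trans (+-monoʳ-≤ i a<m) (≤-reflexive (m+[n∸m]≡n {i} (<⇒≤ (m∸n≢0⇒n<m (m<n⇒n≢0 a<m))))))
    tails : Σ< N (λ x → at lam (i + x)) ≤ Σ< m (λ a → at mu (i + a))
    tails = ≤-trans (tail-bound {lam = lam} 1≤k core shape ss i N)
      (Σ<-mono m (λ a a<m → ≤-reflexive (weight (i + a)
        (in-range a<m))))

  ⊴⇒kKostka≢0 : IsPartition mu → mu ⊴ lam → kKostka k γ mu ≢ 0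
  ⊴⇒kKostka≢0 (desc , pos) dom = nonzero
    (tableau-exists m (at mu) lam core (antitone-≤ (at-antitone desc)) (at-positive pos)
      (λ i _ → subst₂ _≤_ (sym (Σ<-take i mu)) (sym (Σ<-take i lam)) (dom i)) total)
    where
    m = length mu
    N = length lam
    total : ∀ i → Σ< i (at lam) ≤ Σ< m (at mu)
    total i = ≤-trans (m≤m+n _ _) (≤-reflexive (trans (Σ<-at-split lam i N (m≤n+m N i)) (trans |lam|≡|mu| (sym (Σ<-at mu ≤-refl)))))
    nonzero : ∃[ τ ] (Tableau (at γ) τ m × (∀ a → a < m → Residues k (at γ) τ a (at mu a))) → kKostka k γ mu ≢ 0
    nonzero (τ , tab , res) = m<n⇒n≢0 (∈-length (∈-filter⁺ (λ t → T? (isKTableau k mu t)) t∈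
      (isKTableau⁺ {k} {mu} shape ss weight)))
      where
      open Tableau tab
      t = fill γ τ
      t∈ : t ∈ fillings γ m
      t∈ = fillings⁺ γ m τ bound
      shape : HasShape γ m t
      shape = fillings⁻ γ m t∈
      entry≡ : ∀ i {j} → j < at γ i → entry t i j ≡ suc (τ i j)
      entry≡ i = entry-fill γ τ i
      ss : Semistandard γ t
      ss = record
        { row = λ {i} sj<γ → subst₂ _≤_ (sym (entry≡ i (<-trans ≤-refl sj<γ))) (sym (entry≡ i sj<γ)) (s≤s (row sj<γ))
        ; col = λ {i} j<γ → subst₂ _<_ (sym (entry≡ i (<-≤-trans j<γ (Core.antitone core i)))) (sym (entry≡ (suc i) j<γ)) (s≤s (col j<γ))
        }
      resCount≤ : ∀ a → a < m → resCount k t (suc a) ≤ at mu a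
      resCount≤ a a<m with res a a<m
      ... | L , |L| , cov = ≤-trans
        (unique⊆⇒length≤ _≟_ (filter⁺ (λ r → T? (hasResidue k t (suc a) r)) (upTo⁺ (suc k))) ⊆L) (≤-reflexive |L|)
        where
        ⊆L : ∀ {r} → r ∈ residues k t (suc a) → r ∈ L
        ⊆L r∈ with residues⁻ shape k {suc a} r∈
        ... | i , j , j<γ , e , refl = cov j<γ (suc-injective (trans (sym (entry≡ i j<γ)) e))
      weight : ∀ a → a < m → resCount k t (suc a) ≡ at mu a
      -- Each letter has at most its part of residues by construction, and `tail-bound` with `i = 0`
      -- bounds the total from below, so every count is exact.
      weight = Σ<-squeeze m resCount≤
        (≤-trans (≤-reflexive (trans (Σ<-at mu ≤-refl) (trans (sym |lam|≡|mu|) (sym (Σ<-at lam ≤-refl)))))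
          (tail-bound {lam = lam} 1≤k core shape ss 0 N))

theorem3p6 : (k d : ℕ) → 1 ≤ k → 1 ≤ d →
    (lam mu : List ℕ) → IsPartition lam → IsPartition mu →
    Bounded k lam → Bounded k mu → sum lam ≡ d → sum mu ≡ d →
    (γ : List ℕ) → IsCoreOf k lam γ →
    ((kKostka k γ mu ≢ 0) ⇔ (mu ⊴ lam))
theorem3p6 k d 1≤k 1≤d lam mu lam-part mu-part lam≤k mu≤k |lam| |mu| γ (γ-part , γ-core , small) =
  mk⇔ (kKostka≢0⇒⊴ {γ = γ} {lam} 1≤k core |lam|≡|mu|) (⊴⇒kKostka≢0 {γ = γ} {lam} 1≤k core |lam|≡|mu| mu-part)
  where
  core : Core k (at γ) (at lam)
  core = HookCore.core {lam = lam} γ-part γ-core small (at-≤ lam≤k)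
  |lam|≡|mu| : sum lam ≡ sum mu
  |lam|≡|mu| = trans |lam| (sym |mu|)
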